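{- Let $n \ge 1$ and let $f:\{0,1\}^n\to\{0,1\}$ be such that $\|\hat f\|_1 = A$. Then $f$ can be computed by a parity decision tree of size $2^{A^2}n^{2A}$ (that is, by a parity decision tree with at most $2^{A^2}n^{2A}$ leaves).
   Context: Identify $\{0,1\}^n$ with $\mathbb{Z}_2^n$. For $\alpha\in\mathbb{Z}_2^n$ let $\chi_\alpha(x)=(-1)^{\sum_i\alpha_i x_i}$, $\hat f(\alpha)=\mathbb{E}_x[f(x)\chi_\alpha(x)]$ ($x$ uniform in $\mathbb{Z}_2^n$), and $\|\hat f\|_1=\sum_{\alpha}|\hat f(\alpha)|$. A parity decision tree ($\oplus$-DT) is a binary tree in which every internal node is labeled by a linear function $\alpha\in\mathbb{Z}_2^n$ and every leaf by an output value in the range of Boolean functions considered (here $\{0,1\}$). On input $x$, the computation starts at the root; at an internal node labeled $\alpha$ it evaluates $\langle\alpha,x\rangle \bmod 2$ and moves to the left child if the value is $0$ and to the right child if it is $1$; at a leaf it outputs the leaf's label. The tree computes $f$ if on every input $x$ it outputs $f(x)$. Its size is its number of leaves. -}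

module Defs where

open import Data.Bool.Base using (Bool; true; false; _∧_; _xor_; if_then_else_)
open import Data.Integer.Base as ℤ using (+_)
open import Data.Nat.Base as ℕ using (ℕ; zero; suc)
open import Data.Nat.Properties using (m^n≢0)
open import Data.Rational.Base using (ℚ; 0ℚ; 1ℚ; _+_; _*_; -_; _/_; ∣_∣; ↥_; ↧ₙ_)
open import Data.Vec.Base using (Vec; []; _∷_; foldr′; zipWith)
open import Relation.Binary.PropositionalEquality using (_≡_)

-- ℤ₂ is Bool with addition _xor_ and multiplication _∧_ (true is 1).
ℤ₂^ : ℕ → Set
ℤ₂^ n = Vec Bool n

⟨_,_⟩ : ∀ {n} → ℤ₂^ n → ℤ₂^ n → Bool
⟨ α , x ⟩ = foldr′ _xor_ false (zipWith _∧_ α x)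

χ : ∀ {n} → ℤ₂^ n → ℤ₂^ n → ℚ
χ α x = if ⟨ α , x ⟩ then - 1ℚ else 1ℚ

Σ[ℤ₂^_] : ∀ n → (ℤ₂^ n → ℚ) → ℚ
Σ[ℤ₂^ zero  ] g = g []
Σ[ℤ₂^ suc n ] g = Σ[ℤ₂^ n ] (λ x → g (false ∷ x)) + Σ[ℤ₂^ n ] (λ x → g (true ∷ x))

𝔼 : ∀ {n} → (ℤ₂^ n → ℚ) → ℚ
𝔼 {n} g = (+ 1 / (2 ℕ.^ n)) {{m^n≢0 2 n}} * Σ[ℤ₂^ n ] g

toℚ : Bool → ℚ
toℚ b = if b then 1ℚ else 0ℚ

fourier : ∀ {n} → (ℤ₂^ n → Bool) → ℤ₂^ n → ℚ
fourier f α = 𝔼 (λ x → toℚ (f x) * χ α x)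

-- The spectral norm ‖f̂‖₁; it is a sum of finitely many dyadic rationals,
-- so working in ℚ instead of ℝ loses nothing.
spectralNorm : ∀ {n} → (ℤ₂^ n → Bool) → ℚ
spectralNorm {n} f = Σ[ℤ₂^ n ] (λ α → ∣ fourier f α ∣)

data ⊕DT (n : ℕ) : Set where
  leaf : Bool → ⊕DT n
  node : (α : ℤ₂^ n) (left right : ⊕DT n) → ⊕DT n

eval : ∀ {n} → ⊕DT n → ℤ₂^ n → Bool
eval (leaf b)     x = b
eval (node α l r) x = if ⟨ α , x ⟩ then eval r x else eval l x

_Computes_ : ∀ {n} → ⊕DT n → (ℤ₂^ n → Bool) → Set
T Computes f = ∀ x → eval T x ≡ f x

size : ∀ {n} → ⊕DT n → ℕ
size (leaf _)     = 1
size (node _ l r) = size l ℕ.+ size r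

-- The real inequality s ≤ 2ᵃ · mᵇ for rational exponents a, b ≥ 0.
-- With a = p / q and b = r / t, both sides are nonnegative reals, so raising
-- them to the power q · t gives the equivalent s^(q t) ≤ 2^(p t) · m^(r q).
-- Only meaningful for nonnegative a and b, as the sign of the numerators is
-- dropped.
_≤2^_·_^_ : ℕ → ℚ → ℕ → ℚ → Set
s ≤2^ a · m ^ b = s ℕ.^ (q ℕ.* t) ℕ.≤ 2 ℕ.^ (p ℕ.* t) ℕ.* m ℕ.^ (r ℕ.* q)
  where
  p q r t : ℕ
  p = ℤ.∣ ↥ a ∣
  q = ↧ₙ a
  r = ℤ.∣ ↥ b ∣
  t = ↧ₙ b

{-# OPTIONS --safe #-}
module Submission where

-- The Fourier coefficients are scaled by S = 2ⁿ to integers c, with norm K = ∑ |c|. Suppose first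
-- that f is ±1-valued, and let a ≥ b be the two largest |c α|, |c β|. Restricting to the hyperplanes
-- ⟨ α ⊕ β , x ⟩ = e adds up (with signs) the coefficients of each coset of α ⊕ β. As f² is
-- constant, c convolved with itself vanishes at α ⊕ β, so the aligned pair c α, c β is balanced by
-- pairs that cancel: the norm drops by 2a on one hyperplane and by 2b on the other. If a ≥ S / 2,
-- the first drop pays for the branching through the power of n. If a ≤ S / 2, Parseval forces
-- b ≥ (S² − a²) / (K − a), and the branching is paid for by the power of 2. This gives the size bound
-- 2^(B² / 4) · n^B for B = K / S ≥ 2.
-- A {0,1}-valued f with spectral norm A and mean p ≥ 1 / 4 has B ≤ 2A for its ±1-valued version. If
-- p ≤ 1 / 4, restrict along the largest coefficient β ≠ 0: by f² = f, A drops by at least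
-- 1 / 2 on one hyperplane, which the power n^(2A) pays for.

open import Data.Bool.Base using (Bool; true; false; not; _∧_; _xor_; if_then_else_)
import Data.Bool.Properties as Bool
open import Data.Integer.Base
  using (ℤ; +_; -[1+_]; 0ℤ; 1ℤ; -1ℤ; _+_; _*_; -_; _-_; ∣_∣; _⊖_; _≤_; +≤+)
import Data.Integer.Properties as ℤ
import Data.Integer.Tactic.RingSolver as ℤ-Ring
open import Data.Nat.Base as ℕ using (ℕ; zero; suc)
import Data.Nat.Properties as ℕ
import Data.Nat.Tactic.RingSolver as ℕ-Ring
open import Data.Product.Base using (∃-syntax; _×_; _,_; proj₁; proj₂)
open import Data.Rational.Base as ℚ using (ℚ; toℚᵘ; ↥_; ↧ₙ_)
import Data.Rational.Properties as ℚ
open import Data.Rational.Unnormalised.Base as ℚᵘ using (mkℚᵘ; *≡*) renaming (_≃_ to _≃ᵘ_)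
import Data.Rational.Unnormalised.Properties as ℚᵘ
open import Data.Sum.Base using (_⊎_; inj₁; inj₂)
open import Data.Vec.Base using ([]; _∷_; zipWith; replicate)
open import Data.Vec.Properties using (≡-dec; ∷-injective)
open import Function.Base using (_∘_; _$_)
open import Relation.Binary.PropositionalEquality
open import Relation.Nullary using (Dec; yes; no; does; contradiction)
open import Relation.Nullary.Decidable using (dec-true; dec-false)
open import Defs

-- The scale S is never renormalised. Coefficients of a restriction are sums and differences of the
-- old ones, so one S serves the whole recursion and all estimates stay between integers.
--
-- The potential is chosen so that B = 2A turns 2^(B² / 4) · n^B into exactly 2^(A²) · n^(2A). Its
-- exponent is quadratic because lowering B by 2t lowers B² / 4 by t (B - t): a drop of order 1 / B,
-- which is all that Parseval guarantees, is still worth a constant number of bits.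
--
-- The obstacle is b being much smaller than a, since then the second hyperplane gains less than the
-- one bit that a branching costs. In that regime Parseval makes B large, the first hyperplane gains
-- two bits, and the uneven gains still suffice.
--
-- The threshold 1 / 4 is where two conditions meet: |1 - 2p| ≤ 2p, which keeps the ±1-valued
-- version within B ≤ 2A, holds for p ≥ 1 / 4, and the drop 1 - 2p of the other case is at least 1 /
-- 2 for p ≤ 1 / 4.

private variable
  n : ℕ

-- Signs and addition in ℤ₂^n

sgn : Bool → ℤ
sgn false = 1ℤ
sgn true  = -1ℤ

sgn-xor : ∀ a b → sgn (a xor b) ≡ sgn a * sgn b
sgn-xor false false = refl
sgn-xor false true  = refl
sgn-xor true  false = refl
sgn-xor true  true  = refl

infixl 6 _⊕_
_⊕_ : ℤ₂^ n → ℤ₂^ n → ℤ₂^ n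
_⊕_ = zipWith _xor_

𝟎 : ℤ₂^ n
𝟎 = replicate _ false

⊕-identityʳ : (γ : ℤ₂^ n) → γ ⊕ 𝟎 ≡ γ
⊕-identityʳ []      = refl
⊕-identityʳ (b ∷ γ) = cong₂ _∷_ (Bool.xor-identityʳ b) (⊕-identityʳ γ)

⊕-identityˡ : (γ : ℤ₂^ n) → 𝟎 ⊕ γ ≡ γ
⊕-identityˡ []      = refl
⊕-identityˡ (b ∷ γ) = cong (b ∷_) (⊕-identityˡ γ)

⊕-comm : (γ δ : ℤ₂^ n) → γ ⊕ δ ≡ δ ⊕ γ
⊕-comm []      []      = refl
⊕-comm (a ∷ γ) (b ∷ δ) = cong₂ _∷_ (Bool.xor-comm a b) (⊕-comm γ δ)

⊕-cancelʳ : (γ δ : ℤ₂^ n) → γ ⊕ δ ⊕ δ ≡ γ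
⊕-cancelʳ []          []          = refl
⊕-cancelʳ (false ∷ γ) (false ∷ δ) = cong (_ ∷_) (⊕-cancelʳ γ δ)
⊕-cancelʳ (false ∷ γ) (true  ∷ δ) = cong (_ ∷_) (⊕-cancelʳ γ δ)
⊕-cancelʳ (true  ∷ γ) (false ∷ δ) = cong (_ ∷_) (⊕-cancelʳ γ δ)
⊕-cancelʳ (true  ∷ γ) (true  ∷ δ) = cong (_ ∷_) (⊕-cancelʳ γ δ)

⊕-cancelˡ : (γ δ : ℤ₂^ n) → γ ⊕ (γ ⊕ δ) ≡ δ
⊕-cancelˡ γ δ = begin
  γ ⊕ (γ ⊕ δ)  ≡⟨ ⊕-comm γ (γ ⊕ δ) ⟩
  γ ⊕ δ ⊕ γ    ≡⟨ cong (_⊕ γ) (⊕-comm γ δ) ⟩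
  δ ⊕ γ ⊕ γ    ≡⟨ ⊕-cancelʳ δ γ ⟩
  δ            ∎
  where open ≡-Reasoning

sgn-∷ : ∀ a b (γ x : ℤ₂^ n) → sgn ⟨ a ∷ γ , b ∷ x ⟩ ≡ sgn (a ∧ b) * sgn ⟨ γ , x ⟩
sgn-∷ a b γ x = sgn-xor (a ∧ b) ⟨ γ , x ⟩

sgn-⊕ : (γ δ x : ℤ₂^ n) → sgn ⟨ γ ⊕ δ , x ⟩ ≡ sgn ⟨ γ , x ⟩ * sgn ⟨ δ , x ⟩
sgn-⊕ []      []      []      = refl
sgn-⊕ (a ∷ γ) (b ∷ δ) (y ∷ x) = begin
  sgn ⟨ (a ∷ γ) ⊕ (b ∷ δ) , y ∷ x ⟩
    ≡⟨ sgn-∷ (a xor b) y (γ ⊕ δ) x ⟩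
  sgn ((a xor b) ∧ y) * sgn ⟨ γ ⊕ δ , x ⟩
    ≡⟨ cong₂ _*_ (trans (cong sgn (Bool.∧-distribʳ-xor y a b)) (sgn-xor (a ∧ y) (b ∧ y)))
                 (sgn-⊕ γ δ x) ⟩
  sgn (a ∧ y) * sgn (b ∧ y) * (sgn ⟨ γ , x ⟩ * sgn ⟨ δ , x ⟩)
    ≡⟨ interchange (sgn (a ∧ y)) (sgn (b ∧ y)) (sgn ⟨ γ , x ⟩) (sgn ⟨ δ , x ⟩) ⟩
  sgn (a ∧ y) * sgn ⟨ γ , x ⟩ * (sgn (b ∧ y) * sgn ⟨ δ , x ⟩)
    ≡⟨ cong₂ _*_ (sgn-∷ a y γ x) (sgn-∷ b y δ x) ⟨
  sgn ⟨ a ∷ γ , y ∷ x ⟩ * sgn ⟨ b ∷ δ , y ∷ x ⟩ ∎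
  where
  open ≡-Reasoning
  interchange : ∀ p q r s → p * q * (r * s) ≡ p * r * (q * s)
  interchange = ℤ-Ring.solve-∀

-- Sums over ℤ₂^n

infix 8 _↾_
_↾_ : {X : Set} → (ℤ₂^ (suc n) → X) → Bool → ℤ₂^ n → X
(c ↾ b) γ = c (b ∷ γ)

∑ : (ℤ₂^ n → ℤ) → ℤ
∑ {zero}  c = c []
∑ {suc n} c = ∑ (c ↾ false) + ∑ (c ↾ true)

∑-cong : {c d : ℤ₂^ n → ℤ} → (∀ γ → c γ ≡ d γ) → ∑ c ≡ ∑ d
∑-cong {zero}  e = e []
∑-cong {suc n} e = cong₂ _+_ (∑-cong (e ∘ (false ∷_))) (∑-cong (e ∘ (true ∷_)))

+-interchange : ∀ p q r s → p + q + (r + s) ≡ p + r + (q + s)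
+-interchange = ℤ-Ring.solve-∀

∑-+ : (c d : ℤ₂^ n → ℤ) → ∑ (λ γ → c γ + d γ) ≡ ∑ c + ∑ d
∑-+ {zero}  c d = refl
∑-+ {suc n} c d = trans
  (cong₂ _+_ (∑-+ (c ↾ false) (d ↾ false)) (∑-+ (c ↾ true) (d ↾ true)))
  (+-interchange (∑ (c ↾ false)) (∑ (d ↾ false)) (∑ (c ↾ true)) (∑ (d ↾ true)))

∑-* : ∀ k (c : ℤ₂^ n → ℤ) → ∑ (λ γ → k * c γ) ≡ k * ∑ c
∑-* {zero}  k c = refl
∑-* {suc n} k c = trans
  (cong₂ _+_ (∑-* k (c ↾ false)) (∑-* k (c ↾ true)))
  (sym (ℤ.*-distribˡ-+ k (∑ (c ↾ false)) (∑ (c ↾ true))))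

∑-mono : {c d : ℤ₂^ n → ℤ} → (∀ γ → c γ ≤ d γ) → ∑ c ≤ ∑ d
∑-mono {zero}  e = e []
∑-mono {suc n} e = ℤ.+-mono-≤ (∑-mono (e ∘ (false ∷_))) (∑-mono (e ∘ (true ∷_)))

∑-zero : ∑ {n} (λ _ → 0ℤ) ≡ 0ℤ
∑-zero {zero}  = refl
∑-zero {suc n} = cong₂ _+_ (∑-zero {n}) (∑-zero {n})

∑-nonneg : {c : ℤ₂^ n → ℤ} → (∀ γ → 0ℤ ≤ c γ) → 0ℤ ≤ ∑ c
∑-nonneg {n} e = ℤ.≤-trans (ℤ.≤-reflexive (sym (∑-zero {n}))) (∑-mono e)

-- Nonnegativity is asked only off `α`: the later summands are controlled by the second largest
-- coefficient, a bound that may fail at the largest one.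
term≤∑ : ∀ {c : ℤ₂^ n → ℤ} α → (∀ γ → γ ≢ α → 0ℤ ≤ c γ) → c α ≤ ∑ c
term≤∑ {zero} [] nonneg = ℤ.≤-refl
term≤∑ {suc n} {c} (false ∷ α) nonneg = ℤ.≤-trans
  (ℤ.≤-reflexive (sym (ℤ.+-identityʳ (c (false ∷ α)))))
  (ℤ.+-mono-≤ (term≤∑ α (λ γ γ≢α → nonneg (false ∷ γ) (γ≢α ∘ proj₂ ∘ ∷-injective)))
              (∑-nonneg (λ γ → nonneg (true ∷ γ) λ ())))
term≤∑ {suc n} {c} (true ∷ α) nonneg = ℤ.≤-trans
  (ℤ.≤-reflexive (sym (ℤ.+-identityˡ (c (true ∷ α)))))
  (ℤ.+-mono-≤ (∑-nonneg (λ γ → nonneg (false ∷ γ) λ ()))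
              (term≤∑ α (λ γ γ≢α → nonneg (true ∷ γ) (γ≢α ∘ proj₂ ∘ ∷-injective))))

norm : (ℤ₂^ n → ℤ) → ℕ
norm {zero}  c = ∣ c [] ∣
norm {suc n} c = norm (c ↾ false) ℕ.+ norm (c ↾ true)

norm≡∑ : (c : ℤ₂^ n → ℤ) → + norm c ≡ ∑ (λ γ → + ∣ c γ ∣)
norm≡∑ {zero}  c = refl
norm≡∑ {suc n} c = trans (ℤ.pos-+ (norm (c ↾ false)) (norm (c ↾ true)))
  (cong₂ _+_ (norm≡∑ (c ↾ false)) (norm≡∑ (c ↾ true)))

norm-mono : ∀ k {c d : ℤ₂^ n → ℤ} → (∀ γ → ∣ c γ ∣ ℕ.≤ k ℕ.* ∣ d γ ∣) → norm c ℕ.≤ k ℕ.* norm d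
norm-mono {zero}  k e = e []
norm-mono {suc n} k {c} {d} e = ℕ.≤-trans
  (ℕ.+-mono-≤ (norm-mono k {c ↾ false} {d ↾ false} (e ∘ (false ∷_)))
               (norm-mono k {c ↾ true} {d ↾ true} (e ∘ (true ∷_))))
  (ℕ.≤-reflexive (sym (ℕ.*-distribˡ-+ k (norm (d ↾ false)) (norm (d ↾ true)))))

∣c∣≤norm : (c : ℤ₂^ n → ℤ) → ∀ α → ∣ c α ∣ ℕ.≤ norm c
∣c∣≤norm c α = ℤ.drop‿+≤+ (ℤ.≤-trans (term≤∑ {c = λ γ → + ∣ c γ ∣} α λ _ _ → +≤+ ℕ.z≤n)
                                       (ℤ.≤-reflexive (sym (norm≡∑ c))))

-- Fourier transform with integer coefficients

ev : (ℤ₂^ n → ℤ) → ℤ₂^ n → ℤ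
ev c x = ∑ (λ γ → c γ * sgn ⟨ γ , x ⟩)

ev-cong : {c d : ℤ₂^ n → ℤ} → (∀ γ → c γ ≡ d γ) → ∀ x → ev c x ≡ ev d x
ev-cong e x = ∑-cong (λ γ → cong (_* sgn ⟨ γ , x ⟩) (e γ))

ev-+ : (c d : ℤ₂^ n → ℤ) → ∀ x → ev (λ γ → c γ + d γ) x ≡ ev c x + ev d x
ev-+ c d x = trans (∑-cong (λ γ → ℤ.*-distribʳ-+ (sgn ⟨ γ , x ⟩) (c γ) (d γ)))
                   (∑-+ (λ γ → c γ * sgn ⟨ γ , x ⟩) (λ γ → d γ * sgn ⟨ γ , x ⟩))

ev-* : ∀ k (c : ℤ₂^ n → ℤ) → ∀ x → ev (λ γ → k * c γ) x ≡ k * ev c x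
ev-* k c x = trans (∑-cong (λ γ → ℤ.*-assoc k (c γ) (sgn ⟨ γ , x ⟩)))
                   (∑-* k (λ γ → c γ * sgn ⟨ γ , x ⟩))

ev-∷ : (c : ℤ₂^ (suc n) → ℤ) → ∀ b x → ev c (b ∷ x) ≡ ev (c ↾ false) x + sgn b * ev (c ↾ true) x
ev-∷ c b x = cong (λ s → ev (c ↾ false) x + s) (trans
  (∑-cong (λ γ → trans (cong (c (true ∷ γ) *_) (sgn-∷ true b γ x))
                       (rotate (c (true ∷ γ)) (sgn b) (sgn ⟨ γ , x ⟩))))
  (∑-* (sgn b) (λ γ → c (true ∷ γ) * sgn ⟨ γ , x ⟩)))
  where
  rotate : ∀ p q r → p * (q * r) ≡ q * (p * r)
  rotate = ℤ-Ring.solve-∀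

-- Adding or subtracting the values at the two settings of the leading bit isolates twice one half
-- of the coefficients, and 2 cancels in ℤ. This turns pointwise identities between functions into
-- identities between coefficients.
ev-injective : {c d : ℤ₂^ n → ℤ} → (∀ x → ev c x ≡ ev d x) → ∀ γ → c γ ≡ d γ
ev-injective {zero} {c} {d} e [] =
  trans (sym (ℤ.*-identityʳ (c []))) (trans (e []) (ℤ.*-identityʳ (d [])))
ev-injective {suc n} {c} {d} e (b ∷ γ) = ev-injective {c = c ↾ b} {d ↾ b} (half b) γ
  where
  double : Bool → ℤ → ℤ → ℤ
  double b p q = p + sgn false * q + sgn b * (p + sgn true * q)
  double₀ : ∀ p q → p + 1ℤ * q + 1ℤ * (p + -1ℤ * q) ≡ + 2 * p
  double₀ = ℤ-Ring.solve-∀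
  double₁ : ∀ p q → p + 1ℤ * q + -1ℤ * (p + -1ℤ * q) ≡ + 2 * q
  double₁ = ℤ-Ring.solve-∀
  double≡ : ∀ b (c : ℤ₂^ (suc n) → ℤ) x →
            double b (ev (c ↾ false) x) (ev (c ↾ true) x) ≡ + 2 * ev (c ↾ b) x
  double≡ false c x = double₀ (ev (c ↾ false) x) (ev (c ↾ true) x)
  double≡ true  c x = double₁ (ev (c ↾ false) x) (ev (c ↾ true) x)
  e′ : ∀ b x → ev (c ↾ false) x + sgn b * ev (c ↾ true) x ≡ ev (d ↾ false) x + sgn b * ev (d ↾ true) x
  e′ b x = trans (sym (ev-∷ c b x)) (trans (e (b ∷ x)) (ev-∷ d b x))
  half : ∀ b x → ev (c ↾ b) x ≡ ev (d ↾ b) x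
  half b x = ℤ.*-cancelˡ-≡ (+ 2) _ _ (trans (sym (double≡ b c x))
    (trans (cong₂ (λ s t → s + sgn b * t) (e′ false x) (e′ true x)) (double≡ b d x)))

ev-involutive : (φ : ℤ₂^ n → ℤ) → ∀ x → ev (ev φ) x ≡ + (2 ℕ.^ n) * φ x
ev-involutive {zero}  φ [] = trans (ℤ.*-identityʳ (φ [] * 1ℤ)) (ℤ.*-comm (φ []) 1ℤ)
ev-involutive {suc n} φ (b ∷ x) = begin
  ev (ev φ) (b ∷ x)
    ≡⟨ ev-∷ (ev φ) b x ⟩
  ev (ev φ ↾ false) x + sgn b * ev (ev φ ↾ true) x
    ≡⟨ cong₂ (λ s t → s + sgn b * t) (half false) (half true) ⟩
  N * φ (false ∷ x) + sgn false * (N * φ (true ∷ x))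
    + sgn b * (N * φ (false ∷ x) + sgn true * (N * φ (true ∷ x)))
    ≡⟨ collect b ⟩
  + 2 * N * φ (b ∷ x)
    ≡⟨ cong (_* φ (b ∷ x)) (ℤ.pos-* 2 (2 ℕ.^ n)) ⟨
  + (2 ℕ.* 2 ℕ.^ n) * φ (b ∷ x) ∎
  where
  open ≡-Reasoning
  N = + (2 ℕ.^ n)
  half : ∀ a → ev (ev φ ↾ a) x ≡ N * φ (false ∷ x) + sgn a * (N * φ (true ∷ x))
  half a = begin
    ev (ev φ ↾ a) x
      ≡⟨ ev-cong (ev-∷ φ a) x ⟩
    ev (λ γ → ev (φ ↾ false) γ + sgn a * ev (φ ↾ true) γ) x
      ≡⟨ ev-+ (ev (φ ↾ false)) (λ γ → sgn a * ev (φ ↾ true) γ) x ⟩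
    ev (ev (φ ↾ false)) x + ev (λ γ → sgn a * ev (φ ↾ true) γ) x
      ≡⟨ cong₂ _+_ (ev-involutive (φ ↾ false) x)
           (trans (ev-* (sgn a) (ev (φ ↾ true)) x) (cong (sgn a *_) (ev-involutive (φ ↾ true) x))) ⟩
    N * φ (false ∷ x) + sgn a * (N * φ (true ∷ x)) ∎
  collect₀ : ∀ k p q → k * p + 1ℤ * (k * q) + 1ℤ * (k * p + -1ℤ * (k * q)) ≡ + 2 * k * p
  collect₀ = ℤ-Ring.solve-∀
  collect₁ : ∀ k p q → k * p + 1ℤ * (k * q) + -1ℤ * (k * p + -1ℤ * (k * q)) ≡ + 2 * k * q
  collect₁ = ℤ-Ring.solve-∀
  collect : ∀ b → N * φ (false ∷ x) + sgn false * (N * φ (true ∷ x))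
    + sgn b * (N * φ (false ∷ x) + sgn true * (N * φ (true ∷ x))) ≡ + 2 * N * φ (b ∷ x)
  collect false = collect₀ N (φ (false ∷ x)) (φ (true ∷ x))
  collect true  = collect₁ N (φ (false ∷ x)) (φ (true ∷ x))

conv : (c d : ℤ₂^ n → ℤ) → ℤ₂^ n → ℤ
conv c d δ = ∑ (λ γ → c γ * d (γ ⊕ δ))

-- The convolution theorem. In the leading coordinate it is multiplication in the group ring of ℤ₂,
-- evaluated at the sign of `b`.
ev-conv : (c d : ℤ₂^ n → ℤ) → ∀ x → ev (conv c d) x ≡ ev c x * ev d x
ev-conv {zero}  c d [] = unit (c []) (d [])
  where
  unit : ∀ p q → p * q * 1ℤ ≡ p * 1ℤ * (q * 1ℤ)
  unit = ℤ-Ring.solve-∀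
ev-conv {suc n} c d (b ∷ x) = begin
  ev (conv c d) (b ∷ x)
    ≡⟨ ev-∷ (conv c d) b x ⟩
  ev (conv c d ↾ false) x + sgn b * ev (conv c d ↾ true) x
    ≡⟨ cong₂ (λ s t → s + sgn b * t)
         (half (c ↾ false) (d ↾ false) (c ↾ true) (d ↾ true))
         (half (c ↾ false) (d ↾ true) (c ↾ true) (d ↾ false)) ⟩
  p * r + q * s + sgn b * (p * s + q * r)
    ≡⟨ expand b p q r s ⟩
  (p + sgn b * q) * (r + sgn b * s)
    ≡⟨ cong₂ _*_ (ev-∷ c b x) (ev-∷ d b x) ⟨
  ev c (b ∷ x) * ev d (b ∷ x) ∎
  where
  open ≡-Reasoning
  p = ev (c ↾ false) x
  q = ev (c ↾ true) x
  r = ev (d ↾ false) x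
  s = ev (d ↾ true) x
  half : (c₀ d₀ c₁ d₁ : ℤ₂^ n → ℤ) →
         ev (λ δ → conv c₀ d₀ δ + conv c₁ d₁ δ) x ≡ ev c₀ x * ev d₀ x + ev c₁ x * ev d₁ x
  half c₀ d₀ c₁ d₁ = trans (ev-+ (conv c₀ d₀) (conv c₁ d₁) x)
                           (cong₂ _+_ (ev-conv c₀ d₀ x) (ev-conv c₁ d₁ x))
  expand₀ : ∀ p q r s → p * r + q * s + 1ℤ * (p * s + q * r) ≡ (p + 1ℤ * q) * (r + 1ℤ * s)
  expand₀ = ℤ-Ring.solve-∀
  expand₁ : ∀ p q r s → p * r + q * s + -1ℤ * (p * s + q * r) ≡ (p + -1ℤ * q) * (r + -1ℤ * s)
  expand₁ = ℤ-Ring.solve-∀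
  expand : ∀ b p q r s → p * r + q * s + sgn b * (p * s + q * r) ≡ (p + sgn b * q) * (r + sgn b * s)
  expand false = expand₀
  expand true  = expand₁

-- The spectrum of the constant function 1, concentrated at `𝟎`.
unit : ℤ₂^ n → ℤ
unit []          = 1ℤ
unit (false ∷ γ) = unit γ
unit (true  ∷ γ) = 0ℤ

ev-unit : (x : ℤ₂^ n) → ev unit x ≡ 1ℤ
ev-unit []      = refl
ev-unit {suc n} (b ∷ x) = trans (ev-∷ unit b x) (trans
  (cong₂ (λ s t → s + sgn b * t) (ev-unit x) (∑-zero {n}))
  (cong (λ s → 1ℤ + s) (ℤ.*-zeroʳ (sgn b))))

unit-𝟎 : unit {n} 𝟎 ≡ 1ℤ
unit-𝟎 {zero}  = refl
unit-𝟎 {suc n} = unit-𝟎 {n}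

unit-≢𝟎 : (γ : ℤ₂^ n) → γ ≢ 𝟎 → unit γ ≡ 0ℤ
unit-≢𝟎 []          γ≢𝟎 = contradiction refl γ≢𝟎
unit-≢𝟎 (false ∷ γ) γ≢𝟎 = unit-≢𝟎 γ (γ≢𝟎 ∘ cong (false ∷_))
unit-≢𝟎 (true  ∷ γ) γ≢𝟎 = refl

-- Restriction to the affine hyperplane ⟨ δ , x ⟩ = e. A coordinate i with δᵢ = 1
-- (the pivot) is eliminated, which identifies the hyperplane with ℤ₂^n.

data Pivot : ℤ₂^ (suc n) → Set where
  here  : (δ : ℤ₂^ n) → Pivot (true ∷ δ)
  there : ∀ b {δ : ℤ₂^ (suc n)} → Pivot δ → Pivot (b ∷ δ)

pivot : (α β : ℤ₂^ (suc n)) → α ≢ β → Pivot (α ⊕ β)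
pivot (false ∷ α)     (true  ∷ β)     α≢β = here (α ⊕ β)
pivot (true  ∷ α)     (false ∷ β)     α≢β = here (α ⊕ β)
pivot (false ∷ [])    (false ∷ [])    α≢β = contradiction refl α≢β
pivot (true  ∷ [])    (true  ∷ [])    α≢β = contradiction refl α≢β
pivot (false ∷ a ∷ α) (false ∷ b ∷ β) α≢β = there false (pivot (a ∷ α) (b ∷ β) (α≢β ∘ cong (false ∷_)))
pivot (true  ∷ a ∷ α) (true  ∷ b ∷ β) α≢β = there false (pivot (a ∷ α) (b ∷ β) (α≢β ∘ cong (true ∷_)))

private variable
  δ : ℤ₂^ (suc n)

-- Characters of the hyperplane correspond to cosets { γ , γ ⊕ δ }. Exactly one member of a coset
-- has pivot bit 0; `emb p` enumerates these representatives.
emb : Pivot {n} δ → ℤ₂^ n → ℤ₂^ (suc n)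
emb (here δ)    γ       = false ∷ γ
emb (there b p) (g ∷ γ) = g ∷ emb p γ

remove : Pivot {n} δ → ℤ₂^ (suc n) → ℤ₂^ n
remove (here δ)    (a ∷ x) = x
remove (there b p) (a ∷ x) = a ∷ remove p x

insert : Pivot {n} δ → Bool → ℤ₂^ n → ℤ₂^ (suc n)
insert (here δ)    e x       = (e xor ⟨ δ , x ⟩) ∷ x
-- The coordinate `a` already contributes b ∧ a to ⟨ δ , x ⟩, so the remaining coordinates must make
-- up the difference to `e`.
insert (there b p) e (a ∷ x) = a ∷ insert p ((b ∧ a) xor e) x

remove-insert : ∀ (p : Pivot {n} δ) e x → remove p (insert p e x) ≡ x
remove-insert (here δ)    e x       = refl
remove-insert (there b p) e (a ∷ x) = cong (a ∷_) (remove-insert p _ x)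

xor-cancelʳ : ∀ a b → (a xor b) xor b ≡ a
xor-cancelʳ false false = refl
xor-cancelʳ false true  = refl
xor-cancelʳ true  false = refl
xor-cancelʳ true  true  = refl

xor-cancelˡ : ∀ a b → a xor (a xor b) ≡ b
xor-cancelˡ false b     = refl
xor-cancelˡ true  false = refl
xor-cancelˡ true  true  = refl

insert-on : ∀ (p : Pivot {n} δ) e x → ⟨ δ , insert p e x ⟩ ≡ e
insert-on (here δ)    e x       = xor-cancelʳ e ⟨ δ , x ⟩
insert-on (there b p) e (a ∷ x) =
  trans (cong ((b ∧ a) xor_) (insert-on p _ x)) (xor-cancelˡ (b ∧ a) e)

insert-remove : ∀ (p : Pivot {n} δ) x → insert p ⟨ δ , x ⟩ (remove p x) ≡ x
insert-remove (here δ)            (a ∷ x) = cong (_∷ x) (xor-cancelʳ a ⟨ δ , x ⟩)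
insert-remove (there b {δ = δ} p) (a ∷ x) = cong (a ∷_) (trans
  (cong (λ e → insert p e (remove p x)) (xor-cancelˡ (b ∧ a) ⟨ δ , x ⟩))
  (insert-remove p x))

⟨emb,⟩ : ∀ (p : Pivot {n} δ) γ x → ⟨ emb p γ , x ⟩ ≡ ⟨ γ , remove p x ⟩
⟨emb,⟩ (here δ)    γ       (a ∷ x) = refl
⟨emb,⟩ (there b p) (g ∷ γ) (a ∷ x) = cong ((g ∧ a) xor_) (⟨emb,⟩ p γ x)

pivotBit : Pivot {n} δ → ℤ₂^ (suc n) → Bool
pivotBit (here δ)    (a ∷ α) = a
pivotBit (there b p) (a ∷ α) = pivotBit p α

-- The index of the coset containing `α`: an inverse of `emb` up to translation by `δ`.
coset : Pivot {n} δ → ℤ₂^ (suc n) → ℤ₂^ n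
coset {δ = δ} p α = if pivotBit p α then remove p (α ⊕ δ) else remove p α

remove-emb : ∀ (p : Pivot {n} δ) γ → remove p (emb p γ) ≡ γ
remove-emb (here δ)    γ       = refl
remove-emb (there b p) (g ∷ γ) = cong (g ∷_) (remove-emb p γ)

pivotBit-emb : ∀ (p : Pivot {n} δ) γ → pivotBit p (emb p γ) ≡ false
pivotBit-emb (here δ)    γ       = refl
pivotBit-emb (there b p) (g ∷ γ) = pivotBit-emb p γ

pivotBit-⊕ : ∀ (p : Pivot {n} δ) α → pivotBit p (α ⊕ δ) ≡ not (pivotBit p α)
pivotBit-⊕ (here δ)    (false ∷ α) = refl
pivotBit-⊕ (here δ)    (true  ∷ α) = refl
pivotBit-⊕ (there b p) (a ∷ α)     = pivotBit-⊕ p α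

emb-remove : ∀ (p : Pivot {n} δ) α → pivotBit p α ≡ false → emb p (remove p α) ≡ α
emb-remove (here δ)    (false ∷ α) refl = refl
emb-remove (there b p) (a ∷ α)     eq   = cong (a ∷_) (emb-remove p α eq)

coset-emb : ∀ (p : Pivot {n} δ) γ → coset p (emb p γ) ≡ γ
coset-emb p γ rewrite pivotBit-emb p γ = remove-emb p γ

coset-emb-⊕ : ∀ (p : Pivot {n} δ) γ → coset p (emb p γ ⊕ δ) ≡ γ
coset-emb-⊕ {δ = δ} p γ rewrite pivotBit-⊕ p (emb p γ) | pivotBit-emb p γ =
  trans (cong (remove p) (⊕-cancelʳ (emb p γ) δ)) (remove-emb p γ)

emb-coset : ∀ (p : Pivot {n} δ) α → emb p (coset p α) ≡ α ⊎ emb p (coset p α) ≡ α ⊕ δ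
emb-coset {δ = δ} p α with pivotBit p α in eq
... | false = inj₁ (emb-remove p α eq)
... | true  = inj₂ (emb-remove p (α ⊕ δ) (trans (pivotBit-⊕ p α) (cong not eq)))

∑-⊕ : ∀ δ (c : ℤ₂^ n → ℤ) → ∑ (λ γ → c (γ ⊕ δ)) ≡ ∑ c
∑-⊕ []          c = refl
∑-⊕ (false ∷ δ) c = cong₂ _+_ (∑-⊕ δ (c ↾ false)) (∑-⊕ δ (c ↾ true))
∑-⊕ (true  ∷ δ) c = trans (cong₂ _+_ (∑-⊕ δ (c ↾ true)) (∑-⊕ δ (c ↾ false)))
                          (ℤ.+-comm (∑ (c ↾ true)) (∑ (c ↾ false)))

∑-cosets : ∀ (p : Pivot {n} δ) (c : ℤ₂^ (suc n) → ℤ) →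
           ∑ c ≡ ∑ (λ γ → c (emb p γ)) + ∑ (λ γ → c (emb p γ ⊕ δ))
∑-cosets (here δ) c = cong (λ s → ∑ (c ↾ false) + s) (sym (∑-⊕ δ (c ↾ true)))
∑-cosets (there false p) c = trans
  (cong₂ _+_ (∑-cosets p (c ↾ false)) (∑-cosets p (c ↾ true))) (+-interchange (∑ (λ γ → c (false ∷ emb p γ))) _ _ _)
-- Here adding `δ` flips the leading bit, so the translates of one half lie in the other half.
∑-cosets (there true p) c = trans
  (cong₂ _+_ (∑-cosets p (c ↾ false)) (∑-cosets p (c ↾ true))) (cross (∑ (λ γ → c (false ∷ emb p γ))) _ _ _)
  where
  cross : ∀ p q r s → p + q + (r + s) ≡ p + r + (s + q)
  cross = ℤ-Ring.solve-∀

restrict : Pivot {n} δ → Bool → (ℤ₂^ (suc n) → ℤ) → ℤ₂^ n → ℤ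
restrict {δ = δ} p e c γ = c (emb p γ) + sgn e * c (emb p γ ⊕ δ)

ev-insert : ∀ (p : Pivot {n} δ) e c x → ev c (insert p e x) ≡ ev (restrict p e c) x
ev-insert {δ = δ} p e c x = begin
  ev c y
    ≡⟨ ∑-cosets p (λ γ → c γ * sgn ⟨ γ , y ⟩) ⟩
  ∑ (λ γ → c (emb p γ) * sgn ⟨ emb p γ , y ⟩) + ∑ (λ γ → c (emb p γ ⊕ δ) * sgn ⟨ emb p γ ⊕ δ , y ⟩)
    ≡⟨ cong₂ _+_ (∑-cong λ γ → cong (c (emb p γ) *_) (sgn-emb γ)) (∑-cong sgn-emb-⊕) ⟩
  ev (λ γ → c (emb p γ)) x + ev (λ γ → sgn e * c (emb p γ ⊕ δ)) x
    ≡⟨ ev-+ (λ γ → c (emb p γ)) (λ γ → sgn e * c (emb p γ ⊕ δ)) x ⟨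
  ev (restrict p e c) x ∎
  where
  open ≡-Reasoning
  y = insert p e x
  rotate : ∀ p q r → p * (q * r) ≡ r * p * q
  rotate = ℤ-Ring.solve-∀
  sgn-emb : ∀ γ → sgn ⟨ emb p γ , y ⟩ ≡ sgn ⟨ γ , x ⟩
  sgn-emb γ = cong sgn (trans (⟨emb,⟩ p γ y) (cong ⟨ γ ,_⟩ (remove-insert p e x)))
  sgn-emb-⊕ : ∀ γ → c (emb p γ ⊕ δ) * sgn ⟨ emb p γ ⊕ δ , y ⟩ ≡ sgn e * c (emb p γ ⊕ δ) * sgn ⟨ γ , x ⟩
  sgn-emb-⊕ γ = trans
    (cong (c (emb p γ ⊕ δ) *_) (trans (sgn-⊕ (emb p γ) δ y)
      (cong₂ _*_ (sgn-emb γ) (cong sgn (insert-on p e x)))))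
    (rotate (c (emb p γ ⊕ δ)) (sgn ⟨ γ , x ⟩) (sgn e))

relabel : Pivot {n} δ → ⊕DT n → ⊕DT (suc n)
relabel p (leaf b)     = leaf b
relabel p (node α l r) = node (emb p α) (relabel p l) (relabel p r)

eval-relabel : ∀ (p : Pivot {n} δ) T x → eval (relabel p T) x ≡ eval T (remove p x)
eval-relabel p (leaf b)     x = refl
eval-relabel p (node α l r) x rewrite ⟨emb,⟩ p α x with ⟨ α , remove p x ⟩
... | false = eval-relabel p l x
... | true  = eval-relabel p r x

size-relabel : ∀ (p : Pivot {n} δ) T → size (relabel p T) ≡ size T
size-relabel p (leaf b)     = refl
size-relabel p (node α l r) = cong₂ ℕ._+_ (size-relabel p l) (size-relabel p r)

branch : ∀ (p : Pivot {n} δ) {h : ℤ₂^ (suc n) → Bool} (T : Bool → ⊕DT n) →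
         (∀ e → T e Computes (λ x → h (insert p e x))) →
         ∃[ T′ ] (T′ Computes h × size T′ ≡ size (T false) ℕ.+ size (T true))
branch {δ = δ} p {h} T computes =
  node δ (relabel p (T false)) (relabel p (T true)) ,
  correct , cong₂ ℕ._+_ (size-relabel p (T false)) (size-relabel p (T true))
  where
  correct : ∀ x → eval (node δ (relabel p (T false)) (relabel p (T true))) x ≡ h x
  correct x with ⟨ δ , x ⟩ in on
  -- Knowing ⟨ δ , x ⟩ determines the pivot coordinate, so the subtree loses nothing by seeing only
  -- `remove p x`.
  ... | false = trans (eval-relabel p (T false) x) (trans (computes false (remove p x))
                  (cong h (subst (λ e → insert p e (remove p x) ≡ x) on (insert-remove p x))))
  ... | true  = trans (eval-relabel p (T true) x) (trans (computes true (remove p x))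
                  (cong h (subst (λ e → insert p e (remove p x) ≡ x) on (insert-remove p x))))

-- Decrease of the norm under restriction

-- The cancellation when two coefficients merge. Summed over all cosets it is the drop of the norm.
excess : ℤ → ℤ → ℤ
excess x y = + ∣ x ∣ + + ∣ y ∣ - + ∣ x + y ∣

excess-nonneg : ∀ x y → 0ℤ ≤ excess x y
excess-nonneg x y = ℤ.i≤j⇒0≤j-i (ℤ.≤-trans (+≤+ (ℤ.∣i+j∣≤∣i∣+∣j∣ x y))
                                            (ℤ.≤-reflexive (ℤ.pos-+ ∣ x ∣ ∣ y ∣)))

excess-comm : ∀ x y → excess x y ≡ excess y x
excess-comm x y = cong₂ (λ s t → s - + ∣ t ∣) (ℤ.+-comm (+ ∣ x ∣) (+ ∣ y ∣)) (ℤ.+-comm x y)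

excess-neg : ∀ x y → excess (- x) (- y) ≡ excess x y
excess-neg x y = cong₂ _-_ (cong₂ (λ s t → + s + + t) (ℤ.∣-i∣≡∣i∣ x) (ℤ.∣-i∣≡∣i∣ y))
  (cong +_ (trans (cong ∣_∣ (sym (ℤ.neg-distrib-+ x y))) (ℤ.∣-i∣≡∣i∣ (x + y))))

0≤* : ∀ {i j} → 0ℤ ≤ i → 0ℤ ≤ j → 0ℤ ≤ i * j
0≤* {+ m} {+ k} _ _ = ℤ.≤-trans (+≤+ ℕ.z≤n) (ℤ.≤-reflexive (ℤ.pos-* m k))

0≤+ : ∀ {i j} → 0ℤ ≤ i → 0ℤ ≤ j → 0ℤ ≤ i + j
0≤+ = ℤ.+-mono-≤

-- For opposite signs the excess is 2 min(m, k), and m k = min(m, k) · max(m, k) is at most b ·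
-- min(m, k).
opposite-excess : ∀ {b m k} → m ℕ.≤ b → k ℕ.≤ b → 0ℤ ≤ + b * excess (+ m) (- + k) + + 2 * (+ m * - + k)
opposite-excess {b} {m} {k} m≤b k≤b with ℕ.≤-total m k
... | inj₁ m≤k = ℤ.≤-trans (0≤* {+ 2 * + m} (0≤* {+ 2} {+ m} (+≤+ ℕ.z≤n) (+≤+ ℕ.z≤n)) (ℤ.i≤j⇒0≤j-i (+≤+ k≤b)))
  (ℤ.≤-reflexive (trans (lemma (+ b) (+ m) (+ k))
    (cong₂ (λ s t → + b * (+ m + + s - t) + + 2 * (+ m * - + k)) (sym (ℤ.∣-i∣≡∣i∣ (+ k))) (sym (ℤ.∣-∣-≤ (+≤+ m≤k))))))
  where
  lemma : ∀ b m k → + 2 * m * (b - k) ≡ b * (m + k - (k - m)) + + 2 * (m * - k)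
  lemma = ℤ-Ring.solve-∀
... | inj₂ k≤m = ℤ.≤-trans (0≤* {+ 2 * + k} (0≤* {+ 2} {+ k} (+≤+ ℕ.z≤n) (+≤+ ℕ.z≤n)) (ℤ.i≤j⇒0≤j-i (+≤+ m≤b)))
  (ℤ.≤-reflexive (trans (lemma (+ b) (+ m) (+ k))
    (cong₂ (λ s t → + b * (+ m + + s - t) + + 2 * (+ m * - + k)) (sym (ℤ.∣-i∣≡∣i∣ (+ k)))
      (sym (trans (cong +_ (ℤ.∣i-j∣≡∣j-i∣ (+ m) (+ k))) (ℤ.∣-∣-≤ (+≤+ k≤m)))))))
  where
  lemma : ∀ b m k → + 2 * k * (b - m) ≡ b * (m + k - (m - k)) + + 2 * (m * - k)
  lemma = ℤ-Ring.solve-∀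

-- Links cancellation to convolution: over all cosets the first terms sum to `b` times the drop of
-- the norm and the second ones to a convolution value known from f². As `gain-nonneg` makes pairs
-- of entries at most `b` nonnegative, one exceptional pair alone bounds the drop.
gain : ℕ → ℤ → ℤ → ℤ
gain b x y = + b * excess x y + + 2 * (x * y)

gain-nonneg : ∀ {b} x y → ∣ x ∣ ℕ.≤ b → ∣ y ∣ ℕ.≤ b → 0ℤ ≤ gain b x y
gain-nonneg {b} (+ m)    (+ k)    _   _   =
  0≤+ (0≤* {+ b} (+≤+ ℕ.z≤n) (excess-nonneg (+ m) (+ k)))
      (0≤* {+ 2} (+≤+ ℕ.z≤n) (0≤* {+ m} {+ k} (+≤+ ℕ.z≤n) (+≤+ ℕ.z≤n)))
gain-nonneg {b} (+ m)    -[1+ k ] m≤b k≤b = opposite-excess m≤b k≤b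
gain-nonneg {b} -[1+ m ] (+ k)    m≤b k≤b =
  ℤ.≤-trans (opposite-excess k≤b m≤b)
    (ℤ.≤-reflexive (cong₂ (λ s t → + b * s + + 2 * t) (excess-comm (+ k) -[1+ m ]) (ℤ.*-comm (+ k) -[1+ m ])))
gain-nonneg {b} -[1+ m ] -[1+ k ] _   _   =
  0≤+ (0≤* {+ b} (+≤+ ℕ.z≤n) (excess-nonneg -[1+ m ] -[1+ k ])) (+≤+ ℕ.z≤n)

norm-neg : ∀ e (c : ℤ₂^ n → ℤ) → norm (λ γ → sgn e * c γ) ≡ norm c
norm-neg {zero}  false c = cong ∣_∣ (ℤ.*-identityˡ (c []))
norm-neg {zero}  true  c = trans (cong ∣_∣ (ℤ.-1*i≡-i (c []))) (ℤ.∣-i∣≡∣i∣ (c []))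
norm-neg {suc n} e     c = cong₂ ℕ._+_ (norm-neg e (c ↾ false)) (norm-neg e (c ↾ true))

norm-cosets : ∀ (p : Pivot {n} δ) c → norm c ≡ norm (λ γ → c (emb p γ)) ℕ.+ norm (λ γ → c (emb p γ ⊕ δ))
norm-cosets {δ = δ} p c = ℤ.+-injective (begin
  + norm c
    ≡⟨ norm≡∑ c ⟩
  ∑ (λ γ → + ∣ c γ ∣)
    ≡⟨ ∑-cosets p (λ γ → + ∣ c γ ∣) ⟩
  ∑ (λ γ → + ∣ c (emb p γ) ∣) + ∑ (λ γ → + ∣ c (emb p γ ⊕ δ) ∣)
    ≡⟨ cong₂ _+_ (norm≡∑ (λ γ → c (emb p γ))) (norm≡∑ (λ γ → c (emb p γ ⊕ δ))) ⟨
  + norm (λ γ → c (emb p γ)) + + norm (λ γ → c (emb p γ ⊕ δ))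
    ≡⟨ ℤ.pos-+ (norm (λ γ → c (emb p γ))) _ ⟨
  + (norm (λ γ → c (emb p γ)) ℕ.+ norm (λ γ → c (emb p γ ⊕ δ))) ∎)
  where open ≡-Reasoning

∑-excess : (x y : ℤ₂^ n → ℤ) → ∑ (λ γ → excess (x γ) (y γ)) ≡ + norm x + + norm y - + norm (λ γ → x γ + y γ)
∑-excess {zero}  x y = refl
∑-excess {suc n} x y = begin
  ∑ (λ γ → excess (x (false ∷ γ)) (y (false ∷ γ))) + ∑ (λ γ → excess (x (true ∷ γ)) (y (true ∷ γ)))
    ≡⟨ cong₂ _+_ (∑-excess (x ↾ false) (y ↾ false)) (∑-excess (x ↾ true) (y ↾ true)) ⟩
  + p₀ + + q₀ - + r₀ + (+ p₁ + + q₁ - + r₁)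
    ≡⟨ collect (+ p₀) (+ q₀) (+ r₀) (+ p₁) (+ q₁) (+ r₁) ⟩
  + p₀ + + p₁ + (+ q₀ + + q₁) - (+ r₀ + + r₁)
    ≡⟨ cong₂ _-_ (cong₂ _+_ (ℤ.pos-+ p₀ p₁) (ℤ.pos-+ q₀ q₁)) (ℤ.pos-+ r₀ r₁) ⟨
  + (p₀ ℕ.+ p₁) + + (q₀ ℕ.+ q₁) - + (r₀ ℕ.+ r₁) ∎
  where
  open ≡-Reasoning
  p₀ = norm (x ↾ false)
  p₁ = norm (x ↾ true)
  q₀ = norm (y ↾ false)
  q₁ = norm (y ↾ true)
  r₀ = norm {n} (λ γ → x (false ∷ γ) + y (false ∷ γ))
  r₁ = norm {n} (λ γ → x (true ∷ γ) + y (true ∷ γ))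
  collect : ∀ p₀ q₀ r₀ p₁ q₁ r₁ → p₀ + q₀ - r₀ + (p₁ + q₁ - r₁) ≡ p₀ + p₁ + (q₀ + q₁) - (r₀ + r₁)
  collect = ℤ-Ring.solve-∀

∑-excess-cosets : ∀ (p : Pivot {n} δ) e c →
  ∑ (λ γ → excess (c (emb p γ)) (sgn e * c (emb p γ ⊕ δ))) ≡ + norm c - + norm (restrict p e c)
∑-excess-cosets {δ = δ} p e c = trans
  (∑-excess (λ γ → c (emb p γ)) (λ γ → sgn e * c (emb p γ ⊕ δ)))
  (cong (_- + norm (restrict p e c)) (sym (begin
    + norm c
      ≡⟨ cong +_ (norm-cosets p c) ⟩
    + (norm (λ γ → c (emb p γ)) ℕ.+ norm (λ γ → c (emb p γ ⊕ δ)))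
      ≡⟨ cong (λ t → + (norm (λ γ → c (emb p γ)) ℕ.+ t)) (norm-neg e (λ γ → c (emb p γ ⊕ δ))) ⟨
    + (norm (λ γ → c (emb p γ)) ℕ.+ norm (λ γ → sgn e * c (emb p γ ⊕ δ)))
      ≡⟨ ℤ.pos-+ (norm (λ γ → c (emb p γ))) _ ⟩
    + norm (λ γ → c (emb p γ)) + + norm (λ γ → sgn e * c (emb p γ ⊕ δ)) ∎)))
  where open ≡-Reasoning

-- The factor 2 appears because the convolution visits each coset from both of its members.
∑-product-cosets : ∀ (p : Pivot {n} δ) e c →
  ∑ (λ γ → + 2 * (c (emb p γ) * (sgn e * c (emb p γ ⊕ δ)))) ≡ sgn e * conv c c δ
∑-product-cosets {δ = δ} p e c = begin
  ∑ (λ γ → + 2 * (x γ * (sgn e * y γ)))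
    ≡⟨ ∑-cong (λ γ → distribute (sgn e) (x γ) (y γ)) ⟩
  ∑ (λ γ → sgn e * (x γ * y γ + y γ * x γ))
    ≡⟨ ∑-* (sgn e) (λ γ → x γ * y γ + y γ * x γ) ⟩
  sgn e * ∑ (λ γ → x γ * y γ + y γ * x γ)
    ≡⟨ cong (sgn e *_) (∑-+ (λ γ → x γ * y γ) (λ γ → y γ * x γ)) ⟩
  sgn e * (∑ (λ γ → x γ * y γ) + ∑ (λ γ → y γ * x γ))
    ≡⟨ cong (λ t → sgn e * (∑ (λ γ → x γ * y γ) + t))
         (∑-cong (λ γ → cong (λ v → y γ * c v) (sym (⊕-cancelʳ (emb p γ) δ)))) ⟩
  sgn e * (∑ (λ γ → x γ * y γ) + ∑ (λ γ → y γ * c (emb p γ ⊕ δ ⊕ δ)))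
    ≡⟨ cong (sgn e *_) (∑-cosets p (λ γ → c γ * c (γ ⊕ δ))) ⟨
  sgn e * conv c c δ ∎
  where
  open ≡-Reasoning
  x y : ℤ₂^ _ → ℤ
  x γ = c (emb p γ)
  y γ = c (emb p γ ⊕ δ)
  distribute : ∀ s x y → + 2 * (x * (s * y)) ≡ s * (x * y + y * x)
  distribute = ℤ-Ring.solve-∀

-- Invariance of `G` under `δ` makes it irrelevant whether `α` or `α ⊕ δ` is the chosen
-- representative.
coset-term≤∑ : ∀ (p : Pivot {n} δ) α (G : ℤ₂^ (suc n) → ℤ) → (∀ γ → G (γ ⊕ δ) ≡ G γ) →
  (∀ γ → γ ≢ α → γ ⊕ δ ≢ α → 0ℤ ≤ G γ) → G α ≤ ∑ (λ γ → G (emb p γ))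
coset-term≤∑ p α G G-⊕ nonneg = ℤ.≤-trans (ℤ.≤-reflexive (sym G-coset))
  (term≤∑ (coset p α) λ γ γ≢ → nonneg (emb p γ)
    (λ eq → γ≢ (trans (sym (coset-emb p γ)) (cong (coset p) eq)))
    (λ eq → γ≢ (trans (sym (coset-emb-⊕ p γ)) (cong (coset p) eq))))
  where
  G-coset : G (emb p (coset p α)) ≡ G α
  G-coset with emb-coset p α
  ... | inj₁ eq = cong G eq
  ... | inj₂ eq = trans (cong G eq) (G-⊕ α)

-- Multiplying both entries by `sgn e` moves the twist to the other member of the pair, and a common
-- sign does not affect the excess.
excess-twist : ∀ e x y → excess y (sgn e * x) ≡ excess x (sgn e * y)
excess-twist false x y = begin
  excess y (1ℤ * x)  ≡⟨ cong (excess y) (ℤ.*-identityˡ x) ⟩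
  excess y x         ≡⟨ excess-comm y x ⟩
  excess x y         ≡⟨ cong (excess x) (ℤ.*-identityˡ y) ⟨
  excess x (1ℤ * y)  ∎
  where open ≡-Reasoning
excess-twist true x y = begin
  excess y (-1ℤ * x)   ≡⟨ cong (excess y) (ℤ.-1*i≡-i x) ⟩
  excess y (- x)       ≡⟨ excess-comm y (- x) ⟩
  excess (- x) y       ≡⟨ cong (excess (- x)) (ℤ.neg-involutive y) ⟨
  excess (- x) (- - y) ≡⟨ excess-neg x (- y) ⟩
  excess x (- y)       ≡⟨ cong (excess x) (ℤ.-1*i≡-i y) ⟨
  excess x (-1ℤ * y)   ∎
  where open ≡-Reasoning

∣sgn*∣ : ∀ e x → ∣ sgn e * x ∣ ≡ ∣ x ∣
∣sgn*∣ false x = cong ∣_∣ (ℤ.*-identityˡ x)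
∣sgn*∣ true  x = trans (cong ∣_∣ (ℤ.-1*i≡-i x)) (ℤ.∣-i∣≡∣i∣ x)

excess≤drop : ∀ (p : Pivot {n} δ) e c α →
  excess (c α) (sgn e * c (α ⊕ δ)) ≤ + norm c - + norm (restrict p e c)
excess≤drop {δ = δ} p e c α = ℤ.≤-trans
  (coset-term≤∑ p α (λ γ → excess (c γ) (sgn e * c (γ ⊕ δ)))
    (λ γ → trans (cong (λ v → excess (c (γ ⊕ δ)) (sgn e * c v)) (⊕-cancelʳ γ δ)) (excess-twist e (c γ) (c (γ ⊕ δ))))
    (λ γ _ _ → excess-nonneg (c γ) (sgn e * c (γ ⊕ δ))))
  (ℤ.≤-reflexive (∑-excess-cosets p e c))

-- The pair of `α` may contain an entry above `b`, so it is the one kept; all other pairs have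
-- nonnegative gain and are discarded.
gain≤drop : ∀ (p : Pivot {n} δ) e c α b → (∀ γ → γ ≢ α → ∣ c γ ∣ ℕ.≤ b) →
  gain b (c α) (sgn e * c (α ⊕ δ)) ≤ + b * (+ norm c - + norm (restrict p e c)) + sgn e * conv c c δ
gain≤drop {δ = δ} p e c α b bound = ℤ.≤-trans
  (coset-term≤∑ p α (λ γ → gain b (c γ) (sgn e * c (γ ⊕ δ)))
    (λ γ → trans (cong (λ v → gain b (c (γ ⊕ δ)) (sgn e * c v)) (⊕-cancelʳ γ δ))
      (cong₂ (λ s t → + b * s + + 2 * t) (excess-twist e (c γ) (c (γ ⊕ δ))) (twist (sgn e) (c γ) (c (γ ⊕ δ)))))
    (λ γ γ≢α γ⊕δ≢α → gain-nonneg (c γ) (sgn e * c (γ ⊕ δ)) (bound γ γ≢α)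
      (ℕ.≤-trans (ℕ.≤-reflexive (∣sgn*∣ e (c (γ ⊕ δ)))) (bound (γ ⊕ δ) γ⊕δ≢α))))
  (ℤ.≤-reflexive (begin
    ∑ (λ γ → gain b (x γ) (y γ))
      ≡⟨ ∑-+ (λ γ → + b * excess (x γ) (y γ)) (λ γ → + 2 * (x γ * y γ)) ⟩
    ∑ (λ γ → + b * excess (x γ) (y γ)) + ∑ (λ γ → + 2 * (x γ * y γ))
      ≡⟨ cong₂ _+_ (trans (∑-* (+ b) (λ γ → excess (x γ) (y γ))) (cong (+ b *_) (∑-excess-cosets p e c)))
                   (∑-product-cosets p e c) ⟩
    + b * (+ norm c - + norm (restrict p e c)) + sgn e * conv c c δ ∎))
  where
  open ≡-Reasoning
  x y : ℤ₂^ _ → ℤ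
  x γ = c (emb p γ)
  y γ = sgn e * c (emb p γ ⊕ δ)
  twist : ∀ s x y → y * (s * x) ≡ x * (s * y)
  twist = ℤ-Ring.solve-∀

norm-restrict : ∀ (p : Pivot {n} δ) e c → norm (restrict p e c) ℕ.≤ norm c
norm-restrict {δ = δ} p e c = ℤ.drop‿+≤+ (ℤ.0≤i-j⇒j≤i (ℤ.≤-trans
  (excess-nonneg (c 𝟎) (sgn e * c (𝟎 ⊕ δ))) (excess≤drop p e c 𝟎)))

-- Zero is allowed on either side, so some sign `e` always aligns two coefficients.
data Aligned : ℤ → ℤ → Set where
  nonneg : ∀ m k → Aligned (+ m) (+ k)
  nonpos : ∀ m k → Aligned (- + m) (- + k)

align : ∀ x y → ∃[ e ] Aligned x (sgn e * y)
align (+ m)    (+ k)    = false , subst (Aligned (+ m)) (sym (ℤ.*-identityˡ (+ k))) (nonneg m k)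
align (+ m)    -[1+ k ] = true , subst (Aligned (+ m)) (sym (ℤ.-1*i≡-i -[1+ k ])) (nonneg m (suc k))
align -[1+ m ] (+ k)    = true , subst (Aligned -[1+ m ]) (sym (ℤ.-1*i≡-i (+ k))) (nonpos (suc m) k)
align -[1+ m ] -[1+ k ] = false , subst (Aligned -[1+ m ]) (sym (ℤ.*-identityˡ -[1+ k ])) (nonpos (suc m) (suc k))

aligned-* : ∀ {x y} → Aligned x y → x * y ≡ + (∣ x ∣ ℕ.* ∣ y ∣)
aligned-* (nonneg m k) = sym (ℤ.pos-* m k)
aligned-* (nonpos m k) = begin
  - + m * - + k            ≡⟨ lemma (+ m) (+ k) ⟩
  + m * + k                ≡⟨ ℤ.pos-* m k ⟨
  + (m ℕ.* k)              ≡⟨ cong₂ (λ s t → + (s ℕ.* t)) (ℤ.∣-i∣≡∣i∣ (+ m)) (ℤ.∣-i∣≡∣i∣ (+ k)) ⟨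
  + (∣ - + m ∣ ℕ.* ∣ - + k ∣) ∎
  where
  open ≡-Reasoning
  lemma : ∀ i j → - i * - j ≡ i * j
  lemma = ℤ-Ring.solve-∀

opposite-excess≡ : ∀ {m k} → k ℕ.≤ m → excess (+ m) (- + k) ≡ + 2 * + k
opposite-excess≡ {m} {k} k≤m = trans
  (cong₂ (λ s t → + m + + s - t) (ℤ.∣-i∣≡∣i∣ (+ k))
    (trans (cong +_ (ℤ.∣i-j∣≡∣j-i∣ (+ m) (+ k))) (ℤ.∣-∣-≤ (+≤+ k≤m))))
  (lemma (+ m) (+ k))
  where
  lemma : ∀ m k → m + k - (m - k) ≡ + 2 * k
  lemma = ℤ-Ring.solve-∀

aligned-excess : ∀ {x y} → Aligned x y → ∣ y ∣ ℕ.≤ ∣ x ∣ → excess x (- y) ≡ + 2 * + ∣ y ∣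
aligned-excess (nonneg m k) k≤m = opposite-excess≡ k≤m
aligned-excess (nonpos m k) k≤m = trans (excess-neg (+ m) (- + k))
  (trans (opposite-excess≡ (subst₂ ℕ._≤_ (ℤ.∣-i∣≡∣i∣ (+ k)) (ℤ.∣-i∣≡∣i∣ (+ m)) k≤m))
         (cong (λ t → + 2 * + t) (sym (ℤ.∣-i∣≡∣i∣ (+ k)))))

sgn-not : ∀ e x → sgn (not e) * x ≡ - (sgn e * x)
sgn-not false x = trans (ℤ.-1*i≡-i x) (cong -_ (sym (ℤ.*-identityˡ x)))
sgn-not true  x = trans (ℤ.*-identityˡ x) (trans (sym (ℤ.neg-involutive x)) (cong -_ (sym (ℤ.-1*i≡-i x))))

drop⇒≤ : ∀ m k {j} → + j ≤ + m - + k → k ℕ.+ j ℕ.≤ m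
drop⇒≤ m k {j} le = ℤ.drop‿+≤+ (ℤ.≤-trans (ℤ.≤-reflexive (ℤ.pos-+ k j))
  (ℤ.≤-trans (ℤ.+-monoʳ-≤ (+ k) le) (ℤ.≤-reflexive (lemma (+ m) (+ k)))))
  where
  lemma : ∀ m k → k + (m - k) ≡ m
  lemma = ℤ-Ring.solve-∀

positive-cancel : ∀ {b i j} → b ≢ 0 → + b * i ≤ + b * j → i ≤ j
positive-cancel {zero}  b≢0 _  = contradiction refl b≢0
positive-cancel {suc b} b≢0 le = ℤ.*-cancelˡ-≤-pos _ _ (+ suc b) le

-- When c is the spectrum of a ±1-valued function, the products
-- c γ * c (γ ⊕ δ) sum to 0. The aligned pair { α , α ⊕ δ } therefore forces cancellation
-- between the other pairs in one restriction, and it cancels itself in the other one.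
sign-drop : ∀ (p : Pivot {n} δ) c α → conv c c δ ≡ 0ℤ → c (α ⊕ δ) ≢ 0ℤ →
  (∀ γ → γ ≢ α → ∣ c γ ∣ ℕ.≤ ∣ c (α ⊕ δ) ∣) → ∣ c (α ⊕ δ) ∣ ℕ.≤ ∣ c α ∣ →
  ∃[ e ] (norm (restrict p e c) ℕ.+ 2 ℕ.* ∣ c α ∣ ℕ.≤ norm c ×
          norm (restrict p (not e) c) ℕ.+ 2 ℕ.* ∣ c (α ⊕ δ) ∣ ℕ.≤ norm c)
sign-drop {δ = δ} p c α conv≡0 cβ≢0 bound b≤a with align (c α) (c (α ⊕ δ))
... | e , aligned = e ,
  drop⇒≤ (norm c) (norm (restrict p e c)) (positive-cancel (cβ≢0 ∘ ℤ.∣i∣≡0⇒i≡0) (begin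
    + b * + (2 ℕ.* a)
      ≡⟨ cong (+ b *_) (ℤ.pos-* 2 a) ⟩
    + b * (+ 2 * + a)
      ≡⟨ lemma (+ b) (+ a) ⟩
    + 2 * (+ a * + b)
      ≡⟨ cong (+ 2 *_) (trans (sym (ℤ.pos-* a b)) (cong (λ t → + (a ℕ.* t)) (sym (∣sgn*∣ e (c (α ⊕ δ)))))) ⟩
    + 2 * + (a ℕ.* ∣ sgn e * c (α ⊕ δ) ∣)
      ≡⟨ cong (+ 2 *_) (aligned-* aligned) ⟨
    + 2 * (c α * (sgn e * c (α ⊕ δ)))
      ≡⟨ ℤ.+-identityˡ _ ⟨
    0ℤ + + 2 * (c α * (sgn e * c (α ⊕ δ)))
      ≤⟨ ℤ.+-monoˡ-≤ _ (0≤* {+ b} (+≤+ ℕ.z≤n) (excess-nonneg (c α) (sgn e * c (α ⊕ δ)))) ⟩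
    gain b (c α) (sgn e * c (α ⊕ δ))
      ≤⟨ gain≤drop p e c α b bound ⟩
    + b * (+ norm c - + norm (restrict p e c)) + sgn e * conv c c δ
      ≡⟨ cong (λ t → + b * (+ norm c - + norm (restrict p e c)) + t)
              (trans (cong (sgn e *_) conv≡0) (ℤ.*-zeroʳ (sgn e))) ⟩
    + b * (+ norm c - + norm (restrict p e c)) + 0ℤ
      ≡⟨ ℤ.+-identityʳ _ ⟩
    + b * (+ norm c - + norm (restrict p e c)) ∎)) ,
  drop⇒≤ (norm c) (norm (restrict p (not e) c)) (begin
    + (2 ℕ.* b)
      ≡⟨ trans (ℤ.pos-* 2 b) (cong (λ t → + 2 * + t) (sym (∣sgn*∣ e (c (α ⊕ δ))))) ⟩
    + 2 * + ∣ sgn e * c (α ⊕ δ) ∣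
      ≡⟨ aligned-excess aligned (ℕ.≤-trans (ℕ.≤-reflexive (∣sgn*∣ e (c (α ⊕ δ)))) b≤a) ⟨
    excess (c α) (- (sgn e * c (α ⊕ δ)))
      ≡⟨ cong (excess (c α)) (sgn-not e (c (α ⊕ δ))) ⟨
    excess (c α) (sgn (not e) * c (α ⊕ δ))
      ≤⟨ excess≤drop p (not e) c α ⟩
    + norm c - + norm (restrict p (not e) c) ∎)
  where
  open ℤ.≤-Reasoning
  a = ∣ c α ∣
  b = ∣ c (α ⊕ δ) ∣
  lemma : ∀ b a → b * (+ 2 * a) ≡ + 2 * (a * b)
  lemma = ℤ-Ring.solve-∀

oppose : ∀ y → ∃[ e ] sgn e * y ≡ - + ∣ y ∣
oppose (+ k)    = true , ℤ.-1*i≡-i (+ k)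
oppose -[1+ k ] = false , ℤ.*-identityˡ -[1+ k ]

-- Choose `e` so that the coefficient q = |c δ| meets `c 𝟎` with negative sign. The convolution then
-- contributes -S q, while the pair { 𝟎 , δ } has gain at least -2 q · c 𝟎. Dividing by q leaves a
-- drop of at least S - 2 c 𝟎, which is at least S / 2.
indicator-drop : ∀ (p : Pivot {n} δ) c S → conv c c δ ≡ + S * c δ → c δ ≢ 0ℤ →
  (∀ γ → γ ≢ 𝟎 → ∣ c γ ∣ ℕ.≤ ∣ c δ ∣) → + 4 * c 𝟎 ≤ + S →
  ∃[ e ] (2 ℕ.* norm (restrict p e c) ℕ.+ S ℕ.≤ 2 ℕ.* norm c)
indicator-drop {n} {δ = δ} p c S conv≡ cδ≢0 bound small with oppose (c δ)
... | e , opposite = e , drop⇒≤ (2 ℕ.* norm c) (2 ℕ.* norm (restrict p e c)) (begin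
    + S
      ≡⟨ ℤ.+-identityˡ (+ S) ⟨
    0ℤ + + S
      ≤⟨ ℤ.+-monoˡ-≤ (+ S) (ℤ.i≤j⇒0≤j-i small) ⟩
    + S - + 4 * c 𝟎 + + S
      ≡⟨ lemma₁ (+ S) (c 𝟎) ⟩
    + 2 * (+ S - + 2 * c 𝟎)
      ≤⟨ ℤ.*-monoˡ-≤-nonNeg (+ 2) (positive-cancel (cδ≢0 ∘ ℤ.∣i∣≡0⇒i≡0) drop) ⟩
    + 2 * (+ norm c - + norm (restrict p e c))
      ≡⟨ lemma₂ (+ norm c) (+ norm (restrict p e c)) ⟩
    + 2 * + norm c - + 2 * + norm (restrict p e c)
      ≡⟨ cong₂ _-_ (ℤ.pos-* 2 (norm c)) (ℤ.pos-* 2 (norm (restrict p e c))) ⟨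
    + (2 ℕ.* norm c) - + (2 ℕ.* norm (restrict p e c)) ∎)
  where
  open ℤ.≤-Reasoning
  q = ∣ c δ ∣
  D = + norm c - + norm (restrict p e c)
  lemma₁ : ∀ s c → s - + 4 * c + s ≡ + 2 * (s - + 2 * c)
  lemma₁ = ℤ-Ring.solve-∀
  lemma₂ : ∀ i j → + 2 * (i - j) ≡ + 2 * i - + 2 * j
  lemma₂ = ℤ-Ring.solve-∀
  lemma₃ : ∀ q s c → q * (s - + 2 * c) ≡ 0ℤ + + 2 * (c * - q) + s * q
  lemma₃ = ℤ-Ring.solve-∀
  lemma₄ : ∀ q D t y s → q * D + t * (s * y) + s * q ≡ q * D + (s * (t * y) + s * q)
  lemma₄ = ℤ-Ring.solve-∀
  lemma₅ : ∀ q D s → q * D + (s * - q + s * q) ≡ q * D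
  lemma₅ = ℤ-Ring.solve-∀
  drop : + q * (+ S - + 2 * c 𝟎) ≤ + q * D
  drop = begin
    + q * (+ S - + 2 * c 𝟎)
      ≡⟨ lemma₃ (+ q) (+ S) (c 𝟎) ⟩
    0ℤ + + 2 * (c 𝟎 * - + q) + + S * + q
      -- Of the gain of the exceptional pair only the product is kept.
      ≤⟨ ℤ.+-monoˡ-≤ (+ S * + q) (ℤ.+-monoˡ-≤ (+ 2 * (c 𝟎 * - + q))
           (0≤* {+ q} (+≤+ ℕ.z≤n) (excess-nonneg (c 𝟎) (- + q)))) ⟩
    gain q (c 𝟎) (- + q) + + S * + q
      ≡⟨ cong (λ t → gain q (c 𝟎) t + + S * + q)
              (trans (sym opposite) (cong (λ v → sgn e * c v) (sym (⊕-identityˡ δ)))) ⟩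
    gain q (c 𝟎) (sgn e * c (𝟎 ⊕ δ)) + + S * + q
      ≤⟨ ℤ.+-monoˡ-≤ (+ S * + q) (gain≤drop p e c 𝟎 q bound) ⟩
    + q * D + sgn e * conv c c δ + + S * + q
      ≡⟨ cong (λ t → + q * D + sgn e * t + + S * + q) conv≡ ⟩
    + q * D + sgn e * (+ S * c δ) + + S * + q
      ≡⟨ lemma₄ (+ q) D (sgn e) (c δ) (+ S) ⟩
    + q * D + (+ S * (sgn e * c δ) + + S * + q)
      ≡⟨ cong (λ t → + q * D + (+ S * t + + S * + q)) opposite ⟩
    + q * D + (+ S * - + q + + S * + q)
      ≡⟨ lemma₅ (+ q) D (+ S) ⟩
    + q * D ∎

-- Spectra of two-valued functions

-- The scale enters through the two values and is independent of `n`, so restriction preserves the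
-- relation verbatim.
Represents : ℤ → ℤ → (ℤ₂^ n → ℤ) → (ℤ₂^ n → Bool) → Set
Represents lo hi c h = ∀ x → ev c x ≡ (if h x then hi else lo)

represents-restrict : ∀ {lo hi} (p : Pivot {n} δ) e {c h} → Represents lo hi c h →
  Represents lo hi (restrict p e c) (λ x → h (insert p e x))
represents-restrict p e {c} rep x = trans (sym (ev-insert p e c x)) (rep (insert p e x))

∑-single : ∀ {c : ℤ₂^ n → ℤ} α → (∀ γ → γ ≢ α → c γ ≡ 0ℤ) → ∑ c ≡ c α
∑-single {zero}  []          off = refl
∑-single {suc n} {c} (false ∷ α) off = trans
  (cong₂ _+_ (∑-single {c = c ↾ false} α (λ γ γ≢α → off (false ∷ γ) (γ≢α ∘ proj₂ ∘ ∷-injective)))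
             (trans (∑-cong (λ γ → off (true ∷ γ) λ ())) (∑-zero {n})))
  (ℤ.+-identityʳ _)
∑-single {suc n} {c} (true  ∷ α) off = trans
  (cong₂ _+_ (trans (∑-cong (λ γ → off (false ∷ γ) λ ())) (∑-zero {n}))
             (∑-single {c = c ↾ true} α (λ γ γ≢α → off (true ∷ γ) (γ≢α ∘ proj₂ ∘ ∷-injective))))
  (ℤ.+-identityˡ _)

label : ℤ → ℤ → Bool
label hi v = does (v ℤ.≟ hi)

label-correct : ∀ {lo hi v} b → lo ≢ hi → v ≡ (if b then hi else lo) → label hi v ≡ b
label-correct {lo} {hi} false lo≢hi refl = dec-false (lo ℤ.≟ hi) lo≢hi
label-correct {hi = hi} true lo≢hi refl = dec-true (hi ℤ.≟ hi) refl

single-tree : ∀ {lo hi} {c : ℤ₂^ n → ℤ} {h} → lo ≢ hi → Represents lo hi c h →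
  ∀ α → (∀ γ → γ ≢ α → c γ ≡ 0ℤ) → ∃[ T ] (T Computes h × size T ≡ 2)
single-tree {lo = lo} {hi} {c} {h} lo≢hi rep α off =
  node α (leaf (label hi (c α * sgn false))) (leaf (label hi (c α * sgn true))) , correct , refl
  where
  value : ∀ x → c α * sgn ⟨ α , x ⟩ ≡ (if h x then hi else lo)
  value x = trans (sym (∑-single α λ γ γ≢α → trans (cong (_* sgn ⟨ γ , x ⟩) (off γ γ≢α))
                                                    (ℤ.*-zeroˡ (sgn ⟨ γ , x ⟩)))) (rep x)
  correct : ∀ x → eval (node α (leaf (label hi (c α * sgn false))) (leaf (label hi (c α * sgn true)))) x ≡ h x
  correct x with ⟨ α , x ⟩ | value x
  ... | false | v = label-correct (h x) lo≢hi v
  ... | true  | v = label-correct (h x) lo≢hi v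

-- Largest and second largest coefficients

argmax : ∀ (c : ℤ₂^ n → ℤ) → ∃[ α ] (∀ γ → ∣ c γ ∣ ℕ.≤ ∣ c α ∣)
argmax {zero}  c = [] , λ { [] → ℕ.≤-refl }
argmax {suc n} c with argmax (c ↾ false) | argmax (c ↾ true)
... | α , max-α | β , max-β with ℕ.≤-total ∣ c (false ∷ α) ∣ ∣ c (true ∷ β) ∣
...   | inj₁ α≤β = true ∷ β , λ { (false ∷ γ) → ℕ.≤-trans (max-α γ) α≤β ; (true ∷ γ) → max-β γ }
...   | inj₂ β≤α = false ∷ α , λ { (false ∷ γ) → max-α γ ; (true ∷ γ) → ℕ.≤-trans (max-β γ) β≤α }

_≟_ : (γ δ : ℤ₂^ n) → Dec (γ ≡ δ)
_≟_ = ≡-dec Bool._≟_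

erase : ℤ₂^ n → (ℤ₂^ n → ℤ) → ℤ₂^ n → ℤ
erase α c γ = if does (γ ≟ α) then 0ℤ else c γ

erase-≢ : ∀ {α γ : ℤ₂^ n} c → γ ≢ α → erase α c γ ≡ c γ
erase-≢ {α = α} {γ} c γ≢α = cong (λ b → if b then 0ℤ else c γ) (dec-false (γ ≟ α) γ≢α)

argmaxOff : ∀ α (c : ℤ₂^ n → ℤ) → (∀ γ → γ ≢ α → c γ ≡ 0ℤ) ⊎
  ∃[ β ] (β ≢ α × c β ≢ 0ℤ × (∀ γ → γ ≢ α → ∣ c γ ∣ ℕ.≤ ∣ c β ∣))
argmaxOff α c with argmax (erase α c)
... | β , max with β ≟ α
-- The maximum sits at the erased position, where the value is 0, so everything else vanishes.
...   | yes _   = inj₁ λ γ γ≢α → ℤ.∣i∣≡0⇒i≡0 (ℕ.n≤0⇒n≡0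
          (subst (λ t → ∣ t ∣ ℕ.≤ 0) (erase-≢ c γ≢α) (max γ)))
...   | no  β≢α with c β ℤ.≟ 0ℤ
...     | yes cβ≡0 = inj₁ λ γ γ≢α → ℤ.∣i∣≡0⇒i≡0 (ℕ.n≤0⇒n≡0
            (subst₂ (λ s t → ∣ s ∣ ℕ.≤ ∣ t ∣) (erase-≢ c γ≢α) cβ≡0 (max γ)))
...     | no  cβ≢0 = inj₂ (β , β≢α , cβ≢0 , λ γ γ≢α →
            subst (λ s → ∣ s ∣ ℕ.≤ ∣ c β ∣) (erase-≢ c γ≢α) (max γ))

∣∑∣≤norm : (c : ℤ₂^ n → ℤ) → ∣ ∑ c ∣ ℕ.≤ norm c
∣∑∣≤norm {zero}  c = ℕ.≤-refl
∣∑∣≤norm {suc n} c = ℕ.≤-trans (ℤ.∣i+j∣≤∣i∣+∣j∣ (∑ (c ↾ false)) (∑ (c ↾ true)))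
  (ℕ.+-mono-≤ (∣∑∣≤norm (c ↾ false)) (∣∑∣≤norm (c ↾ true)))

∣conv∣≤ : ∀ (c : ℤ₂^ n → ℤ) δ k → (∀ γ → ∣ c γ ∣ ℕ.≤ k) → ∣ conv c c δ ∣ ℕ.≤ k ℕ.* norm c
∣conv∣≤ c δ k bound = ℕ.≤-trans (∣∑∣≤norm (λ γ → c γ * c (γ ⊕ δ)))
  (norm-mono k {λ γ → c γ * c (γ ⊕ δ)} {c} λ γ → ℕ.≤-trans
    (ℕ.≤-reflexive (trans (ℤ.abs-* (c γ) (c (γ ⊕ δ))) (ℕ.*-comm ∣ c γ ∣ ∣ c (γ ⊕ δ) ∣)))
    (ℕ.*-monoˡ-≤ ∣ c γ ∣ (bound (γ ⊕ δ))))

i*i≡ : ∀ i → i * i ≡ + ∣ i ∣ * + ∣ i ∣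
i*i≡ (+ n)    = refl
i*i≡ -[1+ n ] = refl

-- Coefficient identities from f² = 1 and f² = f

module Sign (S : ℕ) {c : ℤ₂^ n → ℤ} {h} (rep : Represents (+ S) (- + S) c h) where

  conv≡ : ∀ δ → conv c c δ ≡ + S * + S * unit δ
  conv≡ = ev-injective λ x → begin
    ev (conv c c) x             ≡⟨ ev-conv c c x ⟩
    ev c x * ev c x             ≡⟨ square x ⟩
    + S * + S                   ≡⟨ ℤ.*-identityʳ (+ S * + S) ⟨
    + S * + S * 1ℤ              ≡⟨ cong (λ t → + S * + S * t) (ev-unit x) ⟨
    + S * + S * ev unit x       ≡⟨ ev-* (+ S * + S) unit x ⟨
    ev (λ γ → + S * + S * unit γ) x ∎
    where
    open ≡-Reasoning
    neg-square : ∀ i → - i * - i ≡ i * i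
    neg-square = ℤ-Ring.solve-∀
    square : ∀ x → ev c x * ev c x ≡ + S * + S
    square x with h x | rep x
    ... | false | eq = cong₂ _*_ eq eq
    ... | true  | eq = trans (cong₂ _*_ eq eq) (neg-square (+ S))

  conv-≢𝟎 : ∀ {δ} → δ ≢ 𝟎 → conv c c δ ≡ 0ℤ
  conv-≢𝟎 {δ} δ≢𝟎 = trans (conv≡ δ) (trans (cong (+ S * + S *_) (unit-≢𝟎 δ δ≢𝟎)) (ℤ.*-zeroʳ (+ S * + S)))

  conv-𝟎 : conv c c 𝟎 ≡ + (S ℕ.* S)
  conv-𝟎 = trans (conv≡ 𝟎) (trans (cong (+ S * + S *_) (unit-𝟎 {n}))
    (trans (ℤ.*-identityʳ (+ S * + S)) (sym (ℤ.pos-* S S))))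

  -- Parseval in the weak form: the sum of squares is at most the maximum times the norm.
  S²≤ : ∀ {k} → (∀ γ → ∣ c γ ∣ ℕ.≤ k) → S ℕ.* S ℕ.≤ k ℕ.* norm c
  S²≤ {k} bound = subst (λ t → ∣ t ∣ ℕ.≤ k ℕ.* norm c) conv-𝟎 (∣conv∣≤ c 𝟎 k bound)

  S≤norm : S ℕ.≤ norm c
  S≤norm = ℕ.≮⇒≥ λ norm<S → ℕ.<⇒≱ (ℕ.*-mono-< norm<S norm<S) (S²≤ (∣c∣≤norm c))

  -- Parseval with the largest square split off: S² ≤ a² + b (K - a), written without subtraction.
  -- It follows by keeping only the term `α` of the sum of |c γ| (b - |c γ|), whose other terms are
  -- nonnegative.
  parseval≤ : ∀ α b → (∀ γ → γ ≢ α → ∣ c γ ∣ ℕ.≤ b) →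
              S ℕ.* S ℕ.+ ∣ c α ∣ ℕ.* b ℕ.≤ ∣ c α ∣ ℕ.* ∣ c α ∣ ℕ.+ b ℕ.* norm c
  parseval≤ α b bound = ℤ.drop‿+≤+ (begin
    + (S ℕ.* S ℕ.+ a ℕ.* b)
      ≡⟨ trans (ℤ.pos-+ (S ℕ.* S) (a ℕ.* b)) (cong (λ t → + (S ℕ.* S) + t) (ℤ.pos-* a b)) ⟩
    + (S ℕ.* S) + + a * + b
      ≡⟨ lemma₁ (+ (S ℕ.* S)) (+ a) (+ b) ⟩
    + (S ℕ.* S) + + a * + a + (+ b * + a - + a * + a)
      ≤⟨ ℤ.+-monoʳ-≤ (+ (S ℕ.* S) + + a * + a) (term≤∑ {c = G} α G-nonneg) ⟩
    + (S ℕ.* S) + + a * + a + ∑ G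
      ≡⟨ cong (λ t → + (S ℕ.* S) + + a * + a + t) ∑G ⟩
    + (S ℕ.* S) + + a * + a + (+ b * + norm c + -1ℤ * + (S ℕ.* S))
      ≡⟨ lemma₂ (+ (S ℕ.* S)) (+ a) (+ b * + norm c) ⟩
    + a * + a + + b * + norm c
      ≡⟨ trans (ℤ.pos-+ (a ℕ.* a) (b ℕ.* norm c)) (cong₂ _+_ (ℤ.pos-* a a) (ℤ.pos-* b (norm c))) ⟨
    + (a ℕ.* a ℕ.+ b ℕ.* norm c) ∎)
    where
    open ℤ.≤-Reasoning
    a = ∣ c α ∣
    G : ℤ₂^ n → ℤ
    G γ = + b * + ∣ c γ ∣ - + ∣ c γ ∣ * + ∣ c γ ∣
    lemma₁ : ∀ s a b → s + a * b ≡ s + a * a + (b * a - a * a)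
    lemma₁ = ℤ-Ring.solve-∀
    lemma₂ : ∀ s a t → s + a * a + (t + -1ℤ * s) ≡ a * a + t
    lemma₂ = ℤ-Ring.solve-∀
    factor : ∀ b x → (b - x) * x ≡ b * x - x * x
    factor = ℤ-Ring.solve-∀
    G-nonneg : ∀ γ → γ ≢ α → 0ℤ ≤ G γ
    G-nonneg γ γ≢α = ℤ.≤-trans
      (0≤* {j = + ∣ c γ ∣} (ℤ.i≤j⇒0≤j-i (+≤+ (bound γ γ≢α))) (+≤+ ℕ.z≤n))
      (ℤ.≤-reflexive (factor (+ b) (+ ∣ c γ ∣)))
    ∑G : ∑ G ≡ + b * + norm c + -1ℤ * + (S ℕ.* S)
    ∑G = trans (∑-cong λ γ → cong (λ t → + b * + ∣ c γ ∣ + t) (square γ))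
      (trans (∑-+ (λ γ → + b * + ∣ c γ ∣) (λ γ → -1ℤ * (c γ * c (γ ⊕ 𝟎))))
        (cong₂ _+_ (trans (∑-* (+ b) (λ γ → + ∣ c γ ∣)) (cong (+ b *_) (sym (norm≡∑ c))))
                   (trans (∑-* -1ℤ (λ γ → c γ * c (γ ⊕ 𝟎))) (cong (-1ℤ *_) conv-𝟎))))
      where
      square : ∀ γ → - (+ ∣ c γ ∣ * + ∣ c γ ∣) ≡ -1ℤ * (c γ * c (γ ⊕ 𝟎))
      square γ = trans (sym (ℤ.-1*i≡-i _)) (cong (-1ℤ *_)
        (trans (sym (i*i≡ (c γ))) (cong (λ v → c γ * c v) (sym (⊕-identityʳ γ)))))

module Indicator (S : ℕ) {c : ℤ₂^ n → ℤ} {h} (rep : Represents 0ℤ (+ S) c h) where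

  conv≡ : ∀ δ → conv c c δ ≡ + S * c δ
  conv≡ = ev-injective λ x → begin
    ev (conv c c) x             ≡⟨ ev-conv c c x ⟩
    ev c x * ev c x             ≡⟨ square x ⟩
    + S * ev c x                ≡⟨ ev-* (+ S) c x ⟨
    ev (λ γ → + S * c γ) x      ∎
    where
    open ≡-Reasoning
    square : ∀ x → ev c x * ev c x ≡ + S * ev c x
    square x with h x | rep x
    ... | false | eq = trans (cong₂ _*_ eq eq) (sym (trans (cong (+ S *_) eq) (ℤ.*-zeroʳ (+ S))))
    ... | true  | eq = cong (_* ev c x) eq

  -- At the largest coefficient `c β`, the identity gives S |c β| = |conv c c β| ≤ |c β| · norm c;
  -- cancel |c β|.
  S≤norm : ∀ {α} → c α ≢ 0ℤ → S ℕ.≤ norm c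
  S≤norm {α} cα≢0 with argmax c
  ... | β , max = cancel ∣ c β ∣ {{ℕ.≢-nonZero cβ≢0}}
    (subst (ℕ._≤ ∣ c β ∣ ℕ.* norm c) (trans (cong ∣_∣ (conv≡ β)) (ℤ.abs-* (+ S) (c β)))
      (∣conv∣≤ c β ∣ c β ∣ max))
    where
    cβ≢0 : ∣ c β ∣ ≢ 0
    cβ≢0 cβ≡0 = cα≢0 (ℤ.∣i∣≡0⇒i≡0 (ℕ.n≤0⇒n≡0 (subst (∣ c α ∣ ℕ.≤_) cβ≡0 (max α))))
    cancel : ∀ k .{{_ : ℕ.NonZero k}} → S ℕ.* k ℕ.≤ k ℕ.* norm c → S ℕ.≤ norm c
    cancel k le = ℕ.*-cancelˡ-≤ k (subst (ℕ._≤ k ℕ.* norm c) (ℕ.*-comm S k) le)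

  -- Passing from h to 1 - 2h doubles every other coefficient in absolute value. At `𝟎` the constant
  -- 1 interferes, and |S - 2 v| ≤ 2 v is what the threshold S ≤ 4 v secures.
  at-𝟎 : ∀ v → + S ≤ + 4 * v → ∣ + S * 1ℤ + - + 2 * v ∣ ℕ.≤ 2 ℕ.* ∣ v ∣
  at-𝟎 (+ k) large = subst (λ i → ∣ i ∣ ℕ.≤ 2 ℕ.* k) (sym difference) bound
    where
    S≤4k : S ℕ.≤ 2 ℕ.* k ℕ.+ 2 ℕ.* k
    S≤4k = ℤ.drop‿+≤+ (subst (+ S ≤_) (trans (sym (ℤ.pos-* 4 k)) (cong +_ (four k))) large)
      where
      four : ∀ k → 4 ℕ.* k ≡ 2 ℕ.* k ℕ.+ 2 ℕ.* k
      four = ℕ-Ring.solve-∀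
    lemma : ∀ s k → s * 1ℤ + - + 2 * k ≡ s - + 2 * k
    lemma = ℤ-Ring.solve-∀
    difference : + S * 1ℤ + - + 2 * + k ≡ S ⊖ 2 ℕ.* k
    difference = trans (lemma (+ S) (+ k))
      (trans (cong (λ t → + S - t) (sym (ℤ.pos-* 2 k))) (ℤ.m-n≡m⊖n S (2 ℕ.* k)))
    bound : ∣ S ⊖ 2 ℕ.* k ∣ ℕ.≤ 2 ℕ.* k
    bound with ℕ.≤-total S (2 ℕ.* k)
    ... | inj₁ S≤2k = ℕ.≤-trans (ℕ.≤-reflexive (ℤ.∣⊖∣-≤ S≤2k)) (ℕ.m∸n≤m (2 ℕ.* k) S)
    ... | inj₂ 2k≤S = ℕ.≤-trans
      (ℕ.≤-reflexive (trans (ℤ.∣m⊖n∣≡∣n⊖m∣ S (2 ℕ.* k)) (ℤ.∣⊖∣-≤ 2k≤S)))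
      (ℕ.m≤n+o⇒m∸n≤o S (2 ℕ.* k) S≤4k)

  -- The scaled spectrum of 1 - 2h, the ±1-valued version of `h`.
  flip : ℤ₂^ n → ℤ
  flip γ = + S * unit γ + - + 2 * c γ

  flip-represents : Represents (+ S) (- + S) flip h
  flip-represents x = trans (ev-+ (λ γ → + S * unit γ) (λ γ → - + 2 * c γ) x) (trans
    (cong₂ _+_ (trans (ev-* (+ S) unit x) (cong (+ S *_) (ev-unit x))) (ev-* (- + 2) c x)) (value (h x) (rep x)))
    where
    value₀ : ∀ s → s * 1ℤ + - + 2 * 0ℤ ≡ s
    value₀ = ℤ-Ring.solve-∀
    value₁ : ∀ s → s * 1ℤ + - + 2 * s ≡ - s
    value₁ = ℤ-Ring.solve-∀
    value : ∀ b {v} → v ≡ (if b then + S else 0ℤ) → + S * 1ℤ + - + 2 * v ≡ (if b then - + S else + S)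
    value false refl = value₀ (+ S)
    value true  refl = value₁ (+ S)

  norm-flip : + S ≤ + 4 * c 𝟎 → norm flip ℕ.≤ 2 ℕ.* norm c
  norm-flip large = norm-mono 2 {flip} {c} bound
    where
    bound : ∀ γ → ∣ flip γ ∣ ℕ.≤ 2 ℕ.* ∣ c γ ∣
    bound γ with γ ≟ 𝟎
    ... | no  γ≢𝟎 = ℕ.≤-reflexive (trans (cong ∣_∣ (trans
      (cong (_+ - + 2 * c γ) (trans (cong (+ S *_) (unit-≢𝟎 γ γ≢𝟎)) (ℤ.*-zeroʳ (+ S))))
      (ℤ.+-identityˡ (- + 2 * c γ)))) (ℤ.abs-* (- + 2) (c γ)))
    ... | yes refl = subst (λ u → ∣ + S * u + - + 2 * c 𝟎 ∣ ℕ.≤ 2 ℕ.* ∣ c 𝟎 ∣) (sym (unit-𝟎 {n}))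
                           (at-𝟎 (c 𝟎) large)

-- Size bounds

^-distrib-* : ∀ a b k → (a ℕ.* b) ℕ.^ k ≡ a ℕ.^ k ℕ.* b ℕ.^ k
^-distrib-* a b zero    = refl
^-distrib-* a b (suc k) = trans (cong (a ℕ.* b ℕ.*_) (^-distrib-* a b k))
                                (lemma a b (a ℕ.^ k) (b ℕ.^ k))
  where
  lemma : ∀ a b x y → a ℕ.* b ℕ.* (x ℕ.* y) ≡ a ℕ.* x ℕ.* (b ℕ.* y)
  lemma = ℕ-Ring.solve-∀

^-cancelˡ-≤ : ∀ k .{{_ : ℕ.NonZero k}} {a b} → a ℕ.^ k ℕ.≤ b ℕ.^ k → a ℕ.≤ b
^-cancelˡ-≤ k le = ℕ.≮⇒≥ λ b<a → ℕ.<⇒≱ (ℕ.^-monoˡ-< k b<a) le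

-- s ≤ 2^(B² / 4) · n^B for B = K / S, raised to the power 4 S².
record Bound (S s n K : ℕ) : Set where
  constructor bounded
  field power-≤ : s ℕ.^ (4 ℕ.* (S ℕ.* S)) ℕ.≤ 2 ℕ.^ (K ℕ.* K) ℕ.* n ℕ.^ (4 ℕ.* (S ℕ.* K))

open Bound

-- The alternative s ≤ 2 is needed for characters (B = 1), where Bound fails at small n.
Small : (S s n K : ℕ) → Set
Small S s n K = s ℕ.≤ 2 ⊎ Bound S s n K

power-bound-mono : ∀ {E E′ m n M M′} .{{_ : ℕ.NonZero n}} → E ℕ.≤ E′ → m ℕ.≤ n → M ℕ.≤ M′ →
  2 ℕ.^ E ℕ.* m ℕ.^ M ℕ.≤ 2 ℕ.^ E′ ℕ.* n ℕ.^ M′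
power-bound-mono {n = n} {M} E≤E′ m≤n M≤M′ =
  ℕ.*-mono-≤ (ℕ.^-monoʳ-≤ 2 E≤E′) (ℕ.≤-trans (ℕ.^-monoˡ-≤ M m≤n) (ℕ.^-monoʳ-≤ n M≤M′))

4S²≤K² : ∀ {S K} → 2 ℕ.* S ℕ.≤ K → 4 ℕ.* (S ℕ.* S) ℕ.≤ K ℕ.* K
4S²≤K² {S} 2S≤K = ℕ.≤-trans (ℕ.≤-reflexive (lemma S)) (ℕ.*-mono-≤ 2S≤K 2S≤K)
  where
  lemma : ∀ S → 4 ℕ.* (S ℕ.* S) ≡ 2 ℕ.* S ℕ.* (2 ℕ.* S)
  lemma = ℕ-Ring.solve-∀

two-bound : ∀ {S s K n M} .{{_ : ℕ.NonZero n}} → s ℕ.≤ 2 → 2 ℕ.* S ℕ.≤ K →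
  s ℕ.^ (4 ℕ.* (S ℕ.* S)) ℕ.≤ 2 ℕ.^ (K ℕ.* K) ℕ.* n ℕ.^ M
two-bound {S} {s} {K} {n} {M} s≤2 2S≤K = begin
  s ℕ.^ (4 ℕ.* (S ℕ.* S))       ≤⟨ ℕ.^-monoˡ-≤ (4 ℕ.* (S ℕ.* S)) s≤2 ⟩
  2 ℕ.^ (4 ℕ.* (S ℕ.* S))       ≤⟨ ℕ.^-monoʳ-≤ 2 (4S²≤K² {S} 2S≤K) ⟩
  2 ℕ.^ (K ℕ.* K)               ≤⟨ ℕ.m≤m*n _ (n ℕ.^ M) {{ℕ.m^n≢0 n M}} ⟩
  2 ℕ.^ (K ℕ.* K) ℕ.* n ℕ.^ M   ∎
  where open ℕ.≤-Reasoning

small-weaken : ∀ {S s m n K K′ M} .{{_ : ℕ.NonZero n}} → Small S s m K′ → 2 ℕ.* S ℕ.≤ K →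
  K′ ℕ.≤ K → m ℕ.≤ n → 4 ℕ.* (S ℕ.* K′) ℕ.≤ M →
  s ℕ.^ (4 ℕ.* (S ℕ.* S)) ℕ.≤ 2 ℕ.^ (K ℕ.* K) ℕ.* n ℕ.^ M
small-weaken {S} {M = M} (inj₁ s≤2)   2S≤K K′≤K m≤n le = two-bound {S} {M = M} s≤2 2S≤K
small-weaken             (inj₂ (bounded bound)) 2S≤K K′≤K m≤n le =
  ℕ.≤-trans bound (power-bound-mono (ℕ.*-mono-≤ K′≤K K′≤K) m≤n le)

small⇒bound : ∀ {S s n K K′} .{{_ : ℕ.NonZero n}} → Small S s n K′ → 2 ℕ.* S ℕ.≤ K → K′ ℕ.≤ K → Bound S s n K
small⇒bound {S} small 2S≤K K′≤K =
  bounded (small-weaken small 2S≤K K′≤K ℕ.≤-refl (ℕ.*-monoʳ-≤ 4 (ℕ.*-monoʳ-≤ S K′≤K)))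

-- Either s is at most n s₁, or s₂ takes up the fraction m / n of s = s₁ + s₂.
fractional-sum : ∀ {m} .{{_ : ℕ.NonZero m}} N L E {s₁ s₂} → let n = suc m in
  s₁ ℕ.^ N ℕ.≤ E ℕ.* n ℕ.^ L → s₂ ℕ.^ N ℕ.≤ E ℕ.* m ℕ.^ (N ℕ.+ L) →
  (s₁ ℕ.+ s₂) ℕ.^ N ℕ.≤ E ℕ.* n ℕ.^ (N ℕ.+ L)
fractional-sum {m} N L E {s₁} {s₂} bound₁ bound₂ with ℕ.≤-total s₂ (m ℕ.* s₁)
... | inj₁ s₂≤ms₁ = begin
  (s₁ ℕ.+ s₂) ℕ.^ N               ≤⟨ ℕ.^-monoˡ-≤ N (ℕ.+-monoʳ-≤ s₁ s₂≤ms₁) ⟩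
  (suc m ℕ.* s₁) ℕ.^ N            ≡⟨ ^-distrib-* (suc m) s₁ N ⟩
  suc m ℕ.^ N ℕ.* s₁ ℕ.^ N        ≤⟨ ℕ.*-monoʳ-≤ (suc m ℕ.^ N) bound₁ ⟩
  suc m ℕ.^ N ℕ.* (E ℕ.* suc m ℕ.^ L) ≡⟨ lemma (suc m ℕ.^ N) E (suc m ℕ.^ L) ⟩
  E ℕ.* (suc m ℕ.^ N ℕ.* suc m ℕ.^ L) ≡⟨ cong (E ℕ.*_) (ℕ.^-distribˡ-+-* (suc m) N L) ⟨
  E ℕ.* suc m ℕ.^ (N ℕ.+ L)       ∎
  where
  open ℕ.≤-Reasoning
  lemma : ∀ p E q → p ℕ.* (E ℕ.* q) ≡ E ℕ.* (p ℕ.* q)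
  lemma = ℕ-Ring.solve-∀
... | inj₂ ms₁≤s₂ = ℕ.*-cancelˡ-≤ (m ℕ.^ N) {{ℕ.m^n≢0 m N}} (begin
  m ℕ.^ N ℕ.* (s₁ ℕ.+ s₂) ℕ.^ N   ≡⟨ ^-distrib-* m (s₁ ℕ.+ s₂) N ⟨
  (m ℕ.* (s₁ ℕ.+ s₂)) ℕ.^ N       ≤⟨ ℕ.^-monoˡ-≤ N (ℕ.≤-trans (ℕ.≤-reflexive (ℕ.*-distribˡ-+ m s₁ s₂))
                                       (ℕ.+-monoˡ-≤ (m ℕ.* s₂) ms₁≤s₂)) ⟩
  (suc m ℕ.* s₂) ℕ.^ N            ≡⟨ ^-distrib-* (suc m) s₂ N ⟩
  suc m ℕ.^ N ℕ.* s₂ ℕ.^ N        ≤⟨ ℕ.*-monoʳ-≤ (suc m ℕ.^ N) bound₂ ⟩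
  suc m ℕ.^ N ℕ.* (E ℕ.* m ℕ.^ (N ℕ.+ L))
    ≡⟨ cong (λ t → suc m ℕ.^ N ℕ.* (E ℕ.* t)) (ℕ.^-distribˡ-+-* m N L) ⟩
  suc m ℕ.^ N ℕ.* (E ℕ.* (m ℕ.^ N ℕ.* m ℕ.^ L))
    ≡⟨ lemma (suc m ℕ.^ N) E (m ℕ.^ N) (m ℕ.^ L) ⟩
  m ℕ.^ N ℕ.* (E ℕ.* (suc m ℕ.^ N ℕ.* m ℕ.^ L))
    ≤⟨ ℕ.*-monoʳ-≤ (m ℕ.^ N) (ℕ.*-monoʳ-≤ E (ℕ.*-monoʳ-≤ (suc m ℕ.^ N) (ℕ.^-monoˡ-≤ L (ℕ.n≤1+n m)))) ⟩
  m ℕ.^ N ℕ.* (E ℕ.* (suc m ℕ.^ N ℕ.* suc m ℕ.^ L))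
    ≡⟨ cong (λ t → m ℕ.^ N ℕ.* (E ℕ.* t)) (ℕ.^-distribˡ-+-* (suc m) N L) ⟨
  m ℕ.^ N ℕ.* (E ℕ.* suc m ℕ.^ (N ℕ.+ L)) ∎)
  where
  open ℕ.≤-Reasoning
  lemma : ∀ p E q r → p ℕ.* (E ℕ.* (q ℕ.* r)) ≡ q ℕ.* (E ℕ.* (p ℕ.* r))
  lemma = ℕ-Ring.solve-∀

-- With B = K / S and n = suc m, one subtree loses 1 from B and the other only a dimension, and n^(B
-- - 1) + (n - 1)^B ≤ n^B for B ≥ 1. After raising to the power N, the exponent B - 1 becomes L.
linear-step : ∀ {S m s₁ s₂ K₁ K₂ K} .{{_ : ℕ.NonZero m}} → 2 ℕ.* S ℕ.≤ K →
  Small S s₁ m K₁ → K₁ ℕ.+ S ℕ.≤ K → Small S s₂ m K₂ → K₂ ℕ.≤ K → Bound S (s₁ ℕ.+ s₂) (suc m) K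
linear-step {S} {m} {s₁} {s₂} {K₁} {K₂} {K} 2S≤K small₁ K₁+S≤K small₂ K₂≤K = bounded $
  subst (λ M → (s₁ ℕ.+ s₂) ℕ.^ N ℕ.≤ 2 ℕ.^ (K ℕ.* K) ℕ.* suc m ℕ.^ M) N+L≡
    (fractional-sum N L (2 ℕ.^ (K ℕ.* K))
      (small-weaken small₁ 2S≤K (ℕ.≤-trans (ℕ.m≤m+n K₁ S) K₁+S≤K) (ℕ.n≤1+n m)
        (ℕ.*-monoʳ-≤ 4 (ℕ.*-monoʳ-≤ S (ℕ.m+n≤o⇒m≤o∸n K₁ K₁+S≤K))))
      (subst (λ M → s₂ ℕ.^ N ℕ.≤ 2 ℕ.^ (K ℕ.* K) ℕ.* m ℕ.^ M) (sym N+L≡) (power-≤ (small⇒bound small₂ 2S≤K K₂≤K))))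
  where
  N = 4 ℕ.* (S ℕ.* S)
  L = 4 ℕ.* (S ℕ.* (K ℕ.∸ S))
  lemma : ∀ S R → 4 ℕ.* (S ℕ.* S) ℕ.+ 4 ℕ.* (S ℕ.* R) ≡ 4 ℕ.* (S ℕ.* (S ℕ.+ R))
  lemma = ℕ-Ring.solve-∀
  N+L≡ : N ℕ.+ L ≡ 4 ℕ.* (S ℕ.* K)
  N+L≡ = trans (lemma S (K ℕ.∸ S)) (cong (λ t → 4 ℕ.* (S ℕ.* t)) (ℕ.m+[n∸m]≡n (ℕ.m+n≤o⇒n≤o K₁ K₁+S≤K)))

-- Put B = K / S, τ = t / S and n = suc m. Passing from B - 2τ to B multiplies 2^(B² / 4) · n^B by
-- 2^(Bτ - τ²) · n^(2τ), at least 2^(Bτ - τ² + 2τ) because n ≥ 2. The first condition on `g` is this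
-- exponent times 4 S², so 4 S² units of `g` are one bit.
gained : ∀ {S m s g K′ K} t .{{_ : ℕ.NonZero m}} → 2 ℕ.* S ℕ.≤ K → Small S s m K′ → K′ ℕ.+ 2 ℕ.* t ℕ.≤ K →
  g ℕ.+ 4 ℕ.* (t ℕ.* t) ℕ.≤ 4 ℕ.* (t ℕ.* K) ℕ.+ 8 ℕ.* (S ℕ.* t) → g ℕ.≤ 8 ℕ.* (S ℕ.* S) →
  2 ℕ.^ g ℕ.* s ℕ.^ (4 ℕ.* (S ℕ.* S)) ℕ.≤ 2 ℕ.^ (K ℕ.* K) ℕ.* suc m ℕ.^ (4 ℕ.* (S ℕ.* K))
-- A small tree may satisfy no `Bound` for its own norm. Instead B ≥ 2 pays: 2^(B² / 4) ≥ 2 covers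
-- the size, and n^B ≥ 4 covers up to two bits of gain.
gained {S} {m} {s} {g} {K′} {K} t 2S≤K (inj₁ s≤2) _ _ g≤ = begin
  2 ℕ.^ g ℕ.* s ℕ.^ N                   ≤⟨ ℕ.*-mono-≤ (ℕ.^-monoʳ-≤ 2 g≤) (ℕ.^-monoˡ-≤ N s≤2) ⟩
  2 ℕ.^ (8 ℕ.* (S ℕ.* S)) ℕ.* 2 ℕ.^ N   ≡⟨ ℕ.*-comm (2 ℕ.^ (8 ℕ.* (S ℕ.* S))) (2 ℕ.^ N) ⟩
  2 ℕ.^ N ℕ.* 2 ℕ.^ (8 ℕ.* (S ℕ.* S))
    ≤⟨ power-bound-mono (4S²≤K² {S} 2S≤K) (ℕ.s≤s (ℕ.>-nonZero⁻¹ m)) (begin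
         8 ℕ.* (S ℕ.* S)         ≡⟨ lemma S ⟩
         4 ℕ.* (S ℕ.* (2 ℕ.* S)) ≤⟨ ℕ.*-monoʳ-≤ 4 (ℕ.*-monoʳ-≤ S 2S≤K) ⟩
         4 ℕ.* (S ℕ.* K)         ∎) ⟩
  2 ℕ.^ (K ℕ.* K) ℕ.* suc m ℕ.^ (4 ℕ.* (S ℕ.* K)) ∎
  where
  open ℕ.≤-Reasoning
  N = 4 ℕ.* (S ℕ.* S)
  lemma : ∀ S → 8 ℕ.* (S ℕ.* S) ≡ 4 ℕ.* (S ℕ.* (2 ℕ.* S))
  lemma = ℕ-Ring.solve-∀
gained {S} {m} {s} {g} {K′} {K} t 2S≤K (inj₂ (bounded bound)) K′+2t≤K g+≤ _ = begin
  2 ℕ.^ g ℕ.* s ℕ.^ (4 ℕ.* (S ℕ.* S))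
    ≤⟨ ℕ.*-mono-≤ (ℕ.^-monoʳ-≤ 2 g≤) bound ⟩
  2 ℕ.^ (G ℕ.+ F) ℕ.* (2 ℕ.^ (K′ ℕ.* K′) ℕ.* m ℕ.^ (4 ℕ.* (S ℕ.* K′)))
    ≤⟨ ℕ.*-monoʳ-≤ (2 ℕ.^ (G ℕ.+ F))
         (power-bound-mono (ℕ.*-mono-≤ K′≤R K′≤R) (ℕ.n≤1+n m) (ℕ.*-monoʳ-≤ 4 (ℕ.*-monoʳ-≤ S K′≤R))) ⟩
  2 ℕ.^ (G ℕ.+ F) ℕ.* (2 ℕ.^ (R ℕ.* R) ℕ.* suc m ℕ.^ (4 ℕ.* (S ℕ.* R)))
    ≡⟨ cong (ℕ._* (2 ℕ.^ (R ℕ.* R) ℕ.* suc m ℕ.^ (4 ℕ.* (S ℕ.* R)))) (ℕ.^-distribˡ-+-* 2 G F) ⟩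
  2 ℕ.^ G ℕ.* 2 ℕ.^ F ℕ.* (2 ℕ.^ (R ℕ.* R) ℕ.* suc m ℕ.^ (4 ℕ.* (S ℕ.* R)))
    ≤⟨ ℕ.*-monoˡ-≤ _ (ℕ.*-monoʳ-≤ (2 ℕ.^ G) (ℕ.^-monoˡ-≤ F (ℕ.s≤s (ℕ.>-nonZero⁻¹ m)))) ⟩
  2 ℕ.^ G ℕ.* suc m ℕ.^ F ℕ.* (2 ℕ.^ (R ℕ.* R) ℕ.* suc m ℕ.^ (4 ℕ.* (S ℕ.* R)))
    ≡⟨ lemma₁ (2 ℕ.^ G) (suc m ℕ.^ F) (2 ℕ.^ (R ℕ.* R)) (suc m ℕ.^ (4 ℕ.* (S ℕ.* R))) ⟩
  2 ℕ.^ G ℕ.* 2 ℕ.^ (R ℕ.* R) ℕ.* (suc m ℕ.^ F ℕ.* suc m ℕ.^ (4 ℕ.* (S ℕ.* R)))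
    ≡⟨ cong₂ ℕ._*_ (ℕ.^-distribˡ-+-* 2 G (R ℕ.* R)) (ℕ.^-distribˡ-+-* (suc m) F (4 ℕ.* (S ℕ.* R))) ⟨
  2 ℕ.^ (G ℕ.+ R ℕ.* R) ℕ.* suc m ℕ.^ (F ℕ.+ 4 ℕ.* (S ℕ.* R))
    ≡⟨ cong₂ (λ p q → 2 ℕ.^ p ℕ.* suc m ℕ.^ q) (lemma₂ R t) (lemma₃ S R t) ⟩
  2 ℕ.^ ((R ℕ.+ 2 ℕ.* t) ℕ.* (R ℕ.+ 2 ℕ.* t)) ℕ.* suc m ℕ.^ (4 ℕ.* (S ℕ.* (R ℕ.+ 2 ℕ.* t)))
    ≡⟨ cong (λ k → 2 ℕ.^ (k ℕ.* k) ℕ.* suc m ℕ.^ (4 ℕ.* (S ℕ.* k))) R+2t≡K ⟩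
  2 ℕ.^ (K ℕ.* K) ℕ.* suc m ℕ.^ (4 ℕ.* (S ℕ.* K)) ∎
  where
  open ℕ.≤-Reasoning
  R = K ℕ.∸ 2 ℕ.* t
  R+2t≡K : R ℕ.+ 2 ℕ.* t ≡ K
  R+2t≡K = ℕ.m∸n+n≡m (ℕ.m+n≤o⇒n≤o K′ K′+2t≤K)
  K′≤R : K′ ℕ.≤ R
  K′≤R = ℕ.m+n≤o⇒m≤o∸n K′ K′+2t≤K
  G = 4 ℕ.* (t ℕ.* R) ℕ.+ 4 ℕ.* (t ℕ.* t)
  F = 8 ℕ.* (S ℕ.* t)
  lemma₁ : ∀ a b c d → a ℕ.* b ℕ.* (c ℕ.* d) ≡ a ℕ.* c ℕ.* (b ℕ.* d)
  lemma₁ = ℕ-Ring.solve-∀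
  lemma₂ : ∀ R t → 4 ℕ.* (t ℕ.* R) ℕ.+ 4 ℕ.* (t ℕ.* t) ℕ.+ R ℕ.* R ≡ (R ℕ.+ 2 ℕ.* t) ℕ.* (R ℕ.+ 2 ℕ.* t)
  lemma₂ = ℕ-Ring.solve-∀
  lemma₃ : ∀ S R t → 8 ℕ.* (S ℕ.* t) ℕ.+ 4 ℕ.* (S ℕ.* R) ≡ 4 ℕ.* (S ℕ.* (R ℕ.+ 2 ℕ.* t))
  lemma₃ = ℕ-Ring.solve-∀
  lemma₄ : ∀ S R t → 4 ℕ.* (t ℕ.* (R ℕ.+ 2 ℕ.* t)) ℕ.+ 8 ℕ.* (S ℕ.* t) ≡
                     4 ℕ.* (t ℕ.* R) ℕ.+ 4 ℕ.* (t ℕ.* t) ℕ.+ 8 ℕ.* (S ℕ.* t) ℕ.+ 4 ℕ.* (t ℕ.* t)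
  lemma₄ = ℕ-Ring.solve-∀
  g≤ : g ℕ.≤ G ℕ.+ F
  g≤ = ℕ.+-cancelʳ-≤ (4 ℕ.* (t ℕ.* t)) g (G ℕ.+ F) (ℕ.≤-trans g+≤ (ℕ.≤-reflexive
    (trans (cong (λ k → 4 ℕ.* (t ℕ.* k) ℕ.+ 8 ℕ.* (S ℕ.* t)) (sym R+2t≡K)) (lemma₄ S R t))))

half-sum : ∀ N X {s₁ s₂} → 2 ℕ.^ N ℕ.* s₁ ℕ.^ N ℕ.≤ X → 2 ℕ.^ N ℕ.* s₂ ℕ.^ N ℕ.≤ X → (s₁ ℕ.+ s₂) ℕ.^ N ℕ.≤ X
half-sum N X {s₁} {s₂} bound₁ bound₂ with ℕ.≤-total s₁ s₂
... | inj₁ s₁≤s₂ = ℕ.≤-trans (ℕ.^-monoˡ-≤ N (ℕ.≤-trans (ℕ.+-monoˡ-≤ s₂ s₁≤s₂)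
    (ℕ.≤-reflexive (cong (s₂ ℕ.+_) (sym (ℕ.+-identityʳ s₂))))))
  (ℕ.≤-trans (ℕ.≤-reflexive (^-distrib-* 2 s₂ N)) bound₂)
... | inj₂ s₂≤s₁ = ℕ.≤-trans (ℕ.^-monoˡ-≤ N (ℕ.≤-trans (ℕ.+-monoʳ-≤ s₁ s₂≤s₁)
    (ℕ.≤-reflexive (cong (s₁ ℕ.+_) (sym (ℕ.+-identityʳ s₁))))))
  (ℕ.≤-trans (ℕ.≤-reflexive (^-distrib-* 2 s₁ N)) bound₁)

-- Either s₁ is at least a quarter of the sum, or s₂ is at least three quarters;
-- the constants fit because (4 / 3)⁴ ≤ 2³.
quarter-sum : ∀ Q X {s₁ s₂} → 2 ℕ.^ (8 ℕ.* Q) ℕ.* s₁ ℕ.^ (4 ℕ.* Q) ℕ.≤ X →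
  2 ℕ.^ (3 ℕ.* Q) ℕ.* s₂ ℕ.^ (4 ℕ.* Q) ℕ.≤ X → (s₁ ℕ.+ s₂) ℕ.^ (4 ℕ.* Q) ℕ.≤ X
quarter-sum Q X {s₁} {s₂} bound₁ bound₂ with ℕ.≤-total s₂ (3 ℕ.* s₁)
... | inj₁ s₂≤3s₁ = begin
  (s₁ ℕ.+ s₂) ℕ.^ N               ≤⟨ ℕ.^-monoˡ-≤ N (ℕ.+-monoʳ-≤ s₁ s₂≤3s₁) ⟩
  (4 ℕ.* s₁) ℕ.^ N                ≡⟨ ^-distrib-* 4 s₁ N ⟩
  4 ℕ.^ N ℕ.* s₁ ℕ.^ N
    ≡⟨ cong (ℕ._* s₁ ℕ.^ N) (trans (ℕ.^-*-assoc 2 2 N) (cong (2 ℕ.^_) (sym (ℕ.*-assoc 2 4 Q)))) ⟩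
  2 ℕ.^ (8 ℕ.* Q) ℕ.* s₁ ℕ.^ N    ≤⟨ bound₁ ⟩
  X                               ∎
  where
  open ℕ.≤-Reasoning
  N = 4 ℕ.* Q
... | inj₂ 3s₁≤s₂ = ℕ.*-cancelˡ-≤ (3 ℕ.^ N) {{ℕ.m^n≢0 3 N}} (begin
  3 ℕ.^ N ℕ.* (s₁ ℕ.+ s₂) ℕ.^ N   ≡⟨ ^-distrib-* 3 (s₁ ℕ.+ s₂) N ⟨
  (3 ℕ.* (s₁ ℕ.+ s₂)) ℕ.^ N
    ≤⟨ ℕ.^-monoˡ-≤ N (ℕ.≤-trans (ℕ.≤-reflexive (ℕ.*-distribˡ-+ 3 s₁ s₂)) (ℕ.+-monoˡ-≤ (3 ℕ.* s₂) 3s₁≤s₂)) ⟩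
  (4 ℕ.* s₂) ℕ.^ N                ≡⟨ ^-distrib-* 4 s₂ N ⟩
  4 ℕ.^ N ℕ.* s₂ ℕ.^ N            ≡⟨ cong (ℕ._* s₂ ℕ.^ N) (ℕ.^-*-assoc 4 4 Q) ⟨
  256 ℕ.^ Q ℕ.* s₂ ℕ.^ N          ≤⟨ ℕ.*-monoˡ-≤ (s₂ ℕ.^ N) (ℕ.^-monoˡ-≤ Q (ℕ.≤ᵇ⇒≤ 256 (81 ℕ.* 8) _)) ⟩
  (81 ℕ.* 8) ℕ.^ Q ℕ.* s₂ ℕ.^ N   ≡⟨ cong (ℕ._* s₂ ℕ.^ N) (^-distrib-* 81 8 Q) ⟩
  81 ℕ.^ Q ℕ.* 8 ℕ.^ Q ℕ.* s₂ ℕ.^ N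
    ≡⟨ cong₂ (λ p q → p ℕ.* q ℕ.* s₂ ℕ.^ N) (ℕ.^-*-assoc 3 4 Q) (ℕ.^-*-assoc 2 3 Q) ⟩
  3 ℕ.^ N ℕ.* 2 ℕ.^ (3 ℕ.* Q) ℕ.* s₂ ℕ.^ N   ≡⟨ ℕ.*-assoc (3 ℕ.^ N) _ _ ⟩
  3 ℕ.^ N ℕ.* (2 ℕ.^ (3 ℕ.* Q) ℕ.* s₂ ℕ.^ N) ≤⟨ ℕ.*-monoʳ-≤ (3 ℕ.^ N) bound₂ ⟩
  3 ℕ.^ N ℕ.* X                   ∎)
  where
  open ℕ.≤-Reasoning
  N = 4 ℕ.* Q

-- Numerical consequences of Parseval

-- In units of S the hypotheses are B ≥ 1 + 2a and a B ≥ 1. Hence B² ≥ B + 2, that is (B - 2) (B +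
-- 1) ≥ 0.
2S≤norm : ∀ S .{{_ : ℕ.NonZero S}} a K → S ℕ.+ 2 ℕ.* a ℕ.≤ K → S ℕ.* S ℕ.≤ a ℕ.* K → 2 ℕ.* S ℕ.≤ K
2S≤norm S a K S+2a≤K S²≤aK with ℕ.≤-total (2 ℕ.* S) K
... | inj₁ 2S≤K = 2S≤K
... | inj₂ K≤2S = ℕ.*-cancelˡ-≤ S (ℕ.+-cancelˡ-≤ (S ℕ.* K) _ _ (begin
  S ℕ.* K ℕ.+ S ℕ.* (2 ℕ.* S)       ≡⟨ lemma₁ S K ⟩
  S ℕ.* K ℕ.+ 2 ℕ.* (S ℕ.* S)       ≤⟨ ℕ.+-monoʳ-≤ (S ℕ.* K) (ℕ.*-monoʳ-≤ 2 S²≤aK) ⟩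
  S ℕ.* K ℕ.+ 2 ℕ.* (a ℕ.* K)       ≡⟨ lemma₂ S a K ⟩
  (S ℕ.+ 2 ℕ.* a) ℕ.* K             ≤⟨ ℕ.*-mono-≤ (ℕ.≤-trans S+2a≤K K≤2S) ℕ.≤-refl ⟩
  2 ℕ.* S ℕ.* K                     ≡⟨ lemma₃ S K ⟩
  S ℕ.* K ℕ.+ S ℕ.* K               ∎))
  where
  open ℕ.≤-Reasoning
  lemma₁ : ∀ S K → S ℕ.* K ℕ.+ S ℕ.* (2 ℕ.* S) ≡ S ℕ.* K ℕ.+ 2 ℕ.* (S ℕ.* S)
  lemma₁ = ℕ-Ring.solve-∀
  lemma₂ : ∀ S a K → S ℕ.* K ℕ.+ 2 ℕ.* (a ℕ.* K) ≡ (S ℕ.+ 2 ℕ.* a) ℕ.* K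
  lemma₂ = ℕ-Ring.solve-∀
  lemma₃ : ∀ S K → 2 ℕ.* S ℕ.* K ≡ S ℕ.* K ℕ.+ S ℕ.* K
  lemma₃ = ℕ-Ring.solve-∀

module _ {S a b K : ℕ} (2a≤S : 2 ℕ.* a ℕ.≤ S) (b≤a : b ℕ.≤ a) (a≤K : a ℕ.≤ K)
         (parseval : S ℕ.* S ℕ.+ a ℕ.* b ℕ.≤ a ℕ.* a ℕ.+ b ℕ.* K) where

  open ℕ.≤-Reasoning

  4a²≤S² : 4 ℕ.* (a ℕ.* a) ℕ.≤ S ℕ.* S
  4a²≤S² = ℕ.≤-trans (ℕ.≤-reflexive (lemma a)) (ℕ.*-mono-≤ 2a≤S 2a≤S)
    where
    lemma : ∀ a → 4 ℕ.* (a ℕ.* a) ≡ 2 ℕ.* a ℕ.* (2 ℕ.* a)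
    lemma = ℕ-Ring.solve-∀

  parseval-b : S ℕ.* S ℕ.+ b ℕ.* b ℕ.≤ a ℕ.* a ℕ.+ b ℕ.* K
  parseval-b = ℕ.≤-trans (ℕ.+-monoʳ-≤ (S ℕ.* S) (ℕ.*-monoˡ-≤ b b≤a)) parseval

  -- One bit for the larger drop. Writing a = b + d and using a ≤ K gives a² ≤ a b + K d, which
  -- reduces Parseval to S² ≤ a K; the term a² is absorbed by 2 S a.
  gain-a : 4 ℕ.* (S ℕ.* S) ℕ.+ 4 ℕ.* (a ℕ.* a) ℕ.≤ 4 ℕ.* (a ℕ.* K) ℕ.+ 8 ℕ.* (S ℕ.* a)
  gain-a = ℕ.+-cancelʳ-≤ (4 ℕ.* (a ℕ.* b)) _ _ (begin
    4 ℕ.* (S ℕ.* S) ℕ.+ 4 ℕ.* (a ℕ.* a) ℕ.+ 4 ℕ.* (a ℕ.* b)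
      ≡⟨ lemma₁ S a b ⟩
    4 ℕ.* (a ℕ.* a) ℕ.+ 4 ℕ.* (S ℕ.* S ℕ.+ a ℕ.* b)
      ≤⟨ ℕ.+-monoʳ-≤ (4 ℕ.* (a ℕ.* a)) (ℕ.*-monoʳ-≤ 4 parseval) ⟩
    4 ℕ.* (a ℕ.* a) ℕ.+ 4 ℕ.* (a ℕ.* a ℕ.+ b ℕ.* K)
      ≡⟨ cong (λ t → 4 ℕ.* (a ℕ.* a) ℕ.+ 4 ℕ.* (a ℕ.* t ℕ.+ b ℕ.* K)) (sym b+d≡a) ⟩
    4 ℕ.* (a ℕ.* a) ℕ.+ 4 ℕ.* (a ℕ.* (b ℕ.+ d) ℕ.+ b ℕ.* K)
      ≤⟨ ℕ.+-mono-≤ (ℕ.*-monoʳ-≤ 4 (ℕ.*-monoˡ-≤ a (ℕ.≤-trans (ℕ.m≤m+n a (a ℕ.+ 0)) (ℕ.≤-trans 2a≤S (ℕ.m≤m+n S S)))))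
                     (ℕ.*-monoʳ-≤ 4 (ℕ.+-monoˡ-≤ (b ℕ.* K)
                       (ℕ.≤-trans (ℕ.≤-reflexive (ℕ.*-distribˡ-+ a b d))
                                  (ℕ.+-monoʳ-≤ (a ℕ.* b) (ℕ.*-monoˡ-≤ d a≤K))))) ⟩
    4 ℕ.* ((S ℕ.+ S) ℕ.* a) ℕ.+ 4 ℕ.* (a ℕ.* b ℕ.+ K ℕ.* d ℕ.+ b ℕ.* K)
      ≡⟨ lemma₂ S a b d K ⟩
    4 ℕ.* ((b ℕ.+ d) ℕ.* K) ℕ.+ 8 ℕ.* (S ℕ.* a) ℕ.+ 4 ℕ.* (a ℕ.* b)
      ≡⟨ cong (λ t → 4 ℕ.* (t ℕ.* K) ℕ.+ 8 ℕ.* (S ℕ.* a) ℕ.+ 4 ℕ.* (a ℕ.* b)) b+d≡a ⟩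
    4 ℕ.* (a ℕ.* K) ℕ.+ 8 ℕ.* (S ℕ.* a) ℕ.+ 4 ℕ.* (a ℕ.* b) ∎)
    where
    d = a ℕ.∸ b
    b+d≡a : b ℕ.+ d ≡ a
    b+d≡a = ℕ.m+[n∸m]≡n b≤a
    lemma₁ : ∀ S a b → 4 ℕ.* (S ℕ.* S) ℕ.+ 4 ℕ.* (a ℕ.* a) ℕ.+ 4 ℕ.* (a ℕ.* b) ≡
                       4 ℕ.* (a ℕ.* a) ℕ.+ 4 ℕ.* (S ℕ.* S ℕ.+ a ℕ.* b)
    lemma₁ = ℕ-Ring.solve-∀
    lemma₂ : ∀ S a b d K → 4 ℕ.* ((S ℕ.+ S) ℕ.* a) ℕ.+ 4 ℕ.* (a ℕ.* b ℕ.+ K ℕ.* d ℕ.+ b ℕ.* K) ≡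
                           4 ℕ.* ((b ℕ.+ d) ℕ.* K) ℕ.+ 8 ℕ.* (S ℕ.* a) ℕ.+ 4 ℕ.* (a ℕ.* b)
    lemma₂ = ℕ-Ring.solve-∀

  gain-b : a ℕ.* a ℕ.≤ 2 ℕ.* (S ℕ.* b) →
           4 ℕ.* (S ℕ.* S) ℕ.+ 4 ℕ.* (b ℕ.* b) ℕ.≤ 4 ℕ.* (b ℕ.* K) ℕ.+ 8 ℕ.* (S ℕ.* b)
  gain-b a²≤2Sb = begin
    4 ℕ.* (S ℕ.* S) ℕ.+ 4 ℕ.* (b ℕ.* b)         ≡⟨ ℕ.*-distribˡ-+ 4 (S ℕ.* S) (b ℕ.* b) ⟨
    4 ℕ.* (S ℕ.* S ℕ.+ b ℕ.* b)                 ≤⟨ ℕ.*-monoʳ-≤ 4 parseval-b ⟩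
    4 ℕ.* (a ℕ.* a ℕ.+ b ℕ.* K)                 ≤⟨ ℕ.*-monoʳ-≤ 4 (ℕ.+-monoˡ-≤ (b ℕ.* K) a²≤2Sb) ⟩
    4 ℕ.* (2 ℕ.* (S ℕ.* b) ℕ.+ b ℕ.* K)         ≡⟨ lemma (S ℕ.* b) (b ℕ.* K) ⟩
    4 ℕ.* (b ℕ.* K) ℕ.+ 8 ℕ.* (S ℕ.* b)         ∎
    where
    lemma : ∀ x y → 4 ℕ.* (2 ℕ.* x ℕ.+ y) ≡ 4 ℕ.* y ℕ.+ 8 ℕ.* x
    lemma = ℕ-Ring.solve-∀

  -- Without a lower bound on b, the a² in Parseval costs up to S² / 4, leaving three quarters of a
  -- bit.
  weak-gain-b : 3 ℕ.* (S ℕ.* S) ℕ.+ 4 ℕ.* (b ℕ.* b) ℕ.≤ 4 ℕ.* (b ℕ.* K) ℕ.+ 8 ℕ.* (S ℕ.* b)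
  weak-gain-b = ℕ.≤-trans (ℕ.+-cancelˡ-≤ (S ℕ.* S) _ _ (begin
    S ℕ.* S ℕ.+ (3 ℕ.* (S ℕ.* S) ℕ.+ 4 ℕ.* (b ℕ.* b)) ≡⟨ lemma (S ℕ.* S) (b ℕ.* b) ⟩
    4 ℕ.* (S ℕ.* S ℕ.+ b ℕ.* b)                       ≤⟨ ℕ.*-monoʳ-≤ 4 parseval-b ⟩
    4 ℕ.* (a ℕ.* a ℕ.+ b ℕ.* K)                       ≡⟨ ℕ.*-distribˡ-+ 4 (a ℕ.* a) (b ℕ.* K) ⟩
    4 ℕ.* (a ℕ.* a) ℕ.+ 4 ℕ.* (b ℕ.* K)               ≤⟨ ℕ.+-monoˡ-≤ (4 ℕ.* (b ℕ.* K)) 4a²≤S² ⟩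
    S ℕ.* S ℕ.+ 4 ℕ.* (b ℕ.* K)                       ∎)) (ℕ.m≤m+n _ _)
    where
    lemma : ∀ x y → x ℕ.+ (3 ℕ.* x ℕ.+ 4 ℕ.* y) ≡ 4 ℕ.* (x ℕ.+ y)
    lemma = ℕ-Ring.solve-∀

  -- With e = K - a, Parseval reads S² ≤ a² + b e. Since b ≤ a² / (2 S) and a ≤ S / 2, it becomes S²
  -- ≤ S² / 4 + a e / 4. So a e cannot be as small as 2 S², and a K = a² + a e yields two bits.
  strong-gain-a : .{{_ : ℕ.NonZero S}} → 2 ℕ.* (S ℕ.* b) ℕ.≤ a ℕ.* a →
    8 ℕ.* (S ℕ.* S) ℕ.+ 4 ℕ.* (a ℕ.* a) ℕ.≤ 4 ℕ.* (a ℕ.* K) ℕ.+ 8 ℕ.* (S ℕ.* a)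
  strong-gain-a 2Sb≤a² = begin
    8 ℕ.* (S ℕ.* S) ℕ.+ 4 ℕ.* (a ℕ.* a)         ≡⟨ lemma₁ (S ℕ.* S) (a ℕ.* a) ⟩
    4 ℕ.* (a ℕ.* a ℕ.+ 2 ℕ.* (S ℕ.* S))         ≤⟨ ℕ.*-monoʳ-≤ 4 (ℕ.+-monoʳ-≤ (a ℕ.* a) 2S²≤ae) ⟩
    4 ℕ.* (a ℕ.* a ℕ.+ a ℕ.* e)                 ≡⟨ cong (4 ℕ.*_) (ℕ.*-distribˡ-+ a a e) ⟨
    4 ℕ.* (a ℕ.* (a ℕ.+ e))                     ≡⟨ cong (λ t → 4 ℕ.* (a ℕ.* t)) a+e≡K ⟩
    4 ℕ.* (a ℕ.* K)                             ≤⟨ ℕ.m≤m+n _ _ ⟩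
    4 ℕ.* (a ℕ.* K) ℕ.+ 8 ℕ.* (S ℕ.* a)         ∎
    where
    e = K ℕ.∸ a
    a+e≡K : a ℕ.+ e ≡ K
    a+e≡K = ℕ.m+[n∸m]≡n a≤K
    lemma₁ : ∀ x y → 8 ℕ.* x ℕ.+ 4 ℕ.* y ≡ 4 ℕ.* (y ℕ.+ 2 ℕ.* x)
    lemma₁ = ℕ-Ring.solve-∀
    lemma₂ : ∀ a b e → a ℕ.* a ℕ.+ b ℕ.* (a ℕ.+ e) ≡ a ℕ.* a ℕ.+ b ℕ.* e ℕ.+ a ℕ.* b
    lemma₂ = ℕ-Ring.solve-∀
    lemma₃ : ∀ S a b e → 4 ℕ.* S ℕ.* (a ℕ.* a ℕ.+ b ℕ.* e) ≡
                         S ℕ.* (4 ℕ.* (a ℕ.* a)) ℕ.+ 2 ℕ.* (2 ℕ.* (S ℕ.* b) ℕ.* e)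
    lemma₃ = ℕ-Ring.solve-∀
    lemma₄ : ∀ a e → 2 ℕ.* (a ℕ.* a ℕ.* e) ≡ 2 ℕ.* a ℕ.* (a ℕ.* e)
    lemma₄ = ℕ-Ring.solve-∀
    lemma₅ : ∀ S x → S ℕ.* x ℕ.+ S ℕ.* (2 ℕ.* x) ≡ 3 ℕ.* S ℕ.* x
    lemma₅ = ℕ-Ring.solve-∀
    S²≤a²+be : S ℕ.* S ℕ.≤ a ℕ.* a ℕ.+ b ℕ.* e
    S²≤a²+be = ℕ.+-cancelʳ-≤ (a ℕ.* b) _ _ (ℕ.≤-trans parseval (ℕ.≤-reflexive
      (trans (cong (λ t → a ℕ.* a ℕ.+ b ℕ.* t) (sym a+e≡K)) (lemma₂ a b e))))
    2S²≤ae : 2 ℕ.* (S ℕ.* S) ℕ.≤ a ℕ.* e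
    2S²≤ae with ℕ.≤-total (2 ℕ.* (S ℕ.* S)) (a ℕ.* e)
    ... | inj₁ le = le
    ... | inj₂ ae≤2S² = contradiction (begin
      4 ℕ.* S ℕ.* (S ℕ.* S)                           ≤⟨ ℕ.*-monoʳ-≤ (4 ℕ.* S) S²≤a²+be ⟩
      4 ℕ.* S ℕ.* (a ℕ.* a ℕ.+ b ℕ.* e)               ≡⟨ lemma₃ S a b e ⟩
      S ℕ.* (4 ℕ.* (a ℕ.* a)) ℕ.+ 2 ℕ.* (2 ℕ.* (S ℕ.* b) ℕ.* e)
        ≤⟨ ℕ.+-mono-≤ (ℕ.*-monoʳ-≤ S 4a²≤S²) (ℕ.*-monoʳ-≤ 2 (ℕ.*-monoˡ-≤ e 2Sb≤a²)) ⟩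
      S ℕ.* (S ℕ.* S) ℕ.+ 2 ℕ.* (a ℕ.* a ℕ.* e)       ≡⟨ cong (S ℕ.* (S ℕ.* S) ℕ.+_) (lemma₄ a e) ⟩
      S ℕ.* (S ℕ.* S) ℕ.+ 2 ℕ.* a ℕ.* (a ℕ.* e)
        ≤⟨ ℕ.+-monoʳ-≤ (S ℕ.* (S ℕ.* S)) (ℕ.*-mono-≤ 2a≤S ae≤2S²) ⟩
      S ℕ.* (S ℕ.* S) ℕ.+ S ℕ.* (2 ℕ.* (S ℕ.* S))     ≡⟨ lemma₅ S (S ℕ.* S) ⟩
      3 ℕ.* S ℕ.* (S ℕ.* S)                           ∎)
      (ℕ.<⇒≱ (ℕ.*-monoˡ-< (S ℕ.* S) {{ℕ.m*n≢0 S S}} (ℕ.*-monoˡ-< S (ℕ.n<1+n 3))))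

  -- If b ≥ a² / (2 S), both subtrees gain a full bit and each is at most half the budget. Otherwise
  -- the gains are 2 and 3 / 4 bits, which `quarter-sum` combines.
  balanced-step : ∀ {m s₁ s₂ K₁ K₂} .{{_ : ℕ.NonZero S}} .{{_ : ℕ.NonZero m}} → 2 ℕ.* S ℕ.≤ K →
    Small S s₁ m K₁ → K₁ ℕ.+ 2 ℕ.* a ℕ.≤ K → Small S s₂ m K₂ → K₂ ℕ.+ 2 ℕ.* b ℕ.≤ K →
    Bound S (s₁ ℕ.+ s₂) (suc m) K
  balanced-step {m} 2S≤K small₁ drop₁ small₂ drop₂ with ℕ.≤-total (a ℕ.* a) (2 ℕ.* (S ℕ.* b))
  ... | inj₁ a²≤2Sb = bounded $ half-sum (4 ℕ.* (S ℕ.* S)) X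
    (gained a 2S≤K small₁ drop₁ gain-a 4≤8) (gained b 2S≤K small₂ drop₂ (gain-b a²≤2Sb) 4≤8)
    where
    X = 2 ℕ.^ (K ℕ.* K) ℕ.* suc m ℕ.^ (4 ℕ.* (S ℕ.* K))
    4≤8 = ℕ.*-monoˡ-≤ (S ℕ.* S) (ℕ.m≤m+n 4 4)
  ... | inj₂ 2Sb≤a² = bounded $ quarter-sum (S ℕ.* S) X
    (gained a 2S≤K small₁ drop₁ (strong-gain-a 2Sb≤a²) ℕ.≤-refl)
    (gained b 2S≤K small₂ drop₂ weak-gain-b (ℕ.*-monoˡ-≤ (S ℕ.* S) (ℕ.m≤m+n 3 5)))
    where
    X = 2 ℕ.^ (K ℕ.* K) ℕ.* suc m ℕ.^ (4 ℕ.* (S ℕ.* K))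

-- Construction of the trees

SmallTree : (S : ℕ) (h : ℤ₂^ n → Bool) (K : ℕ) → Set
SmallTree {n} S h K = ∃[ T ] (T Computes h × Small S (size T) n K)

constant-tree : ∀ {S K} (h : ℤ₂^ 0 → Bool) → SmallTree S h K
constant-tree h = leaf (h []) , (λ { [] → refl }) , inj₁ (ℕ.s≤s ℕ.z≤n)

one-variable-tree : ∀ {S K} (h : ℤ₂^ 1 → Bool) → SmallTree S h K
one-variable-tree h with branch (here []) {h} (λ e → leaf (h (insert (here []) e []))) (λ { e [] → refl })
... | T , computes , size≡ = T , computes , inj₁ (ℕ.≤-reflexive size≡)

single-small-tree : ∀ {S K lo hi} {c : ℤ₂^ n → ℤ} {h} → lo ≢ hi → Represents lo hi c h →
  ∀ α → (∀ γ → γ ≢ α → c γ ≡ 0ℤ) → SmallTree S h K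
single-small-tree lo≢hi rep α off with single-tree lo≢hi rep α off
... | T , computes , size≡ = T , computes , inj₁ (ℕ.≤-reflexive size≡)

branch-small : ∀ {S K} (p : Pivot {n} δ) {h} (T : Bool → ⊕DT n) →
  (∀ e → T e Computes (λ x → h (insert p e x))) →
  ∀ e → Bound S (size (T e) ℕ.+ size (T (not e))) (suc n) K → SmallTree S h K
branch-small {n} {S = S} {K} p {h} T computes e bound with branch p {h} T computes
... | T′ , computes′ , size≡ = T′ , computes′ , inj₂ (subst (λ s → Bound S s (suc n) K) (trans (order e) (sym size≡)) bound)
  where
  order : ∀ e → size (T e) ℕ.+ size (T (not e)) ≡ size (T false) ℕ.+ size (T true)
  order false = refl
  order true  = ℕ.+-comm (size (T true)) (size (T false))

small-mono : ∀ {S s n K K′} .{{_ : ℕ.NonZero n}} → K ℕ.≤ K′ → Small S s n K → Small S s n K′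
small-mono {S} K≤K′ (inj₁ s≤2)             = inj₁ s≤2
small-mono {S} K≤K′ (inj₂ (bounded bound)) = inj₂ (bounded (ℕ.≤-trans bound
  (power-bound-mono (ℕ.*-mono-≤ K≤K′ K≤K′) ℕ.≤-refl (ℕ.*-monoʳ-≤ 4 (ℕ.*-monoʳ-≤ S K≤K′)))))

+S≢-S : ∀ S .{{_ : ℕ.NonZero S}} → + S ≢ - + S
+S≢-S (suc S) ()

0≢+S : ∀ S .{{_ : ℕ.NonZero S}} → 0ℤ ≢ + S
0≢+S (suc S) ()

Children : (S : ℕ) → Pivot {n} δ → (ℤ₂^ (suc n) → ℤ) → (ℤ₂^ (suc n) → Bool) → ((ℤ₂^ n → ℤ) → ℕ) → Set
Children S p c h K = ∀ e → SmallTree S (λ x → h (insert p e x)) (K (restrict p e c))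

join : ∀ {S c h K k} (p : Pivot {n} δ) (children : Children S p c h K) → ∀ e →
  Bound S (size (proj₁ (children e)) ℕ.+ size (proj₁ (children (not e)))) (suc n) k → SmallTree S h k
join p children e bound = branch-small p (λ e → proj₁ (children e)) (λ e → proj₁ (proj₂ (children e))) e bound

sign-step : ∀ S .{{_ : ℕ.NonZero S}} .{{_ : ℕ.NonZero n}} {c : ℤ₂^ (suc n) → ℤ} {h} →
  Represents (+ S) (- + S) c h → (p : Pivot δ) → Children S p c h norm →
  ∀ α → (∀ γ → ∣ c γ ∣ ℕ.≤ ∣ c α ∣) → α ⊕ δ ≢ α → c (α ⊕ δ) ≢ 0ℤ →
  (∀ γ → γ ≢ α → ∣ c γ ∣ ℕ.≤ ∣ c (α ⊕ δ) ∣) → SmallTree S h (norm c)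
sign-step {n} {δ} S {c} {h} rep p children α max β≢α cβ≢0 max₂ =
  combine (sign-drop p c α (conv-≢𝟎 δ≢𝟎) cβ≢0 max₂ (max (α ⊕ δ)))
  where
  open Sign S {c = c} rep
  δ≢𝟎 : δ ≢ 𝟎
  δ≢𝟎 δ≡𝟎 = β≢α (trans (cong (α ⊕_) δ≡𝟎) (⊕-identityʳ α))
  a = ∣ c α ∣
  b = ∣ c (α ⊕ δ) ∣
  small : ∀ e → Small S (size (proj₁ (children e))) n (norm (restrict p e c))
  small e = proj₂ (proj₂ (children e))
  S≤child : ∀ e → S ℕ.≤ norm (restrict p e c)
  S≤child e = Sign.S≤norm S {c = restrict p e c} (represents-restrict p e {c} {h} rep)
  combine : ∃[ e ] (norm (restrict p e c) ℕ.+ 2 ℕ.* a ℕ.≤ norm c ×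
                    norm (restrict p (not e) c) ℕ.+ 2 ℕ.* b ℕ.≤ norm c) → SmallTree S h (norm c)
  combine (e , drop₁ , drop₂) = join {c = c} {K = norm} p children e bound
    where
    -- The child whose norm drops by 2a is again ±S-valued, so at least S remains after the drop.
    2S≤K : 2 ℕ.* S ℕ.≤ norm c
    2S≤K = 2S≤norm S a (norm c) (ℕ.≤-trans (ℕ.+-monoˡ-≤ (2 ℕ.* a) (S≤child e)) drop₁) (S²≤ max)
    bound : Bound S (size (proj₁ (children e)) ℕ.+ size (proj₁ (children (not e)))) (suc n) (norm c)
    bound with ℕ.≤-total S (2 ℕ.* a)
    ... | inj₁ S≤2a = linear-step 2S≤K
      (small e) (ℕ.≤-trans (ℕ.+-monoʳ-≤ (norm (restrict p e c)) S≤2a) drop₁)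
      (small (not e)) (norm-restrict p (not e) c)
    ... | inj₂ 2a≤S = balanced-step 2a≤S (max (α ⊕ δ)) (∣c∣≤norm c α) (parseval≤ α b max₂) 2S≤K
      (small e) drop₁ (small (not e)) drop₂

indicator-step : ∀ S .{{_ : ℕ.NonZero S}} .{{_ : ℕ.NonZero n}} {c : ℤ₂^ (suc n) → ℤ} {h} →
  Represents 0ℤ (+ S) c h → (p : Pivot δ) → Children S p c h (λ d → 2 ℕ.* norm d) →
  c δ ≢ 0ℤ → (∀ γ → γ ≢ 𝟎 → ∣ c γ ∣ ℕ.≤ ∣ c δ ∣) → + 4 * c 𝟎 ≤ + S → SmallTree S h (2 ℕ.* norm c)
indicator-step {δ = δ} S {c} rep p children cδ≢0 max small =
  combine (indicator-drop p c S (conv≡ δ) cδ≢0 max small)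
  where
  open Indicator S {c = c} rep
  combine : ∃[ e ] (2 ℕ.* norm (restrict p e c) ℕ.+ S ℕ.≤ 2 ℕ.* norm c) → SmallTree S _ (2 ℕ.* norm c)
  combine (e , drop) = join {c = c} {K = λ d → 2 ℕ.* norm d} p children e
    (linear-step (ℕ.*-monoʳ-≤ 2 (S≤norm cδ≢0))
      (proj₂ (proj₂ (children e))) drop
      (proj₂ (proj₂ (children (not e)))) (ℕ.*-monoʳ-≤ 2 (norm-restrict p (not e) c)))

sign-node : ∀ S .{{_ : ℕ.NonZero S}} .{{_ : ℕ.NonZero n}} →
  (∀ (d : ℤ₂^ n → ℤ) h → Represents (+ S) (- + S) d h → SmallTree S h (norm d)) →
  ∀ (c : ℤ₂^ (suc n) → ℤ) h → Represents (+ S) (- + S) c h → SmallTree S h (norm c)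
sign-node {n} S tree c h rep = node-at (argmax c)
  where
  Second : ℤ₂^ (suc n) → ℤ₂^ (suc n) → Set
  Second α β = β ≢ α × c β ≢ 0ℤ × (∀ γ → γ ≢ α → ∣ c γ ∣ ℕ.≤ ∣ c β ∣)
  split : ∀ {α δ} → (∀ γ → ∣ c γ ∣ ℕ.≤ ∣ c α ∣) → Pivot δ → Second α (α ⊕ δ) → SmallTree S h (norm c)
  split {α} max p (β≢α , cβ≢0 , max₂) = sign-step S {c} {h} rep p
    (λ e → tree (restrict p e c) (λ x → h (insert p e x)) (represents-restrict p e {c} {h} rep)) α max β≢α cβ≢0 max₂
  node-at : ∃[ α ] (∀ γ → ∣ c γ ∣ ℕ.≤ ∣ c α ∣) → SmallTree S h (norm c)
  node-at (α , max) with argmaxOff α c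
  ... | inj₁ off          = single-small-tree {c = c} {h} (+S≢-S S) rep α off
  ... | inj₂ (β , second) =
    split max (pivot α β (proj₁ second ∘ sym)) (subst (Second α) (sym (⊕-cancelˡ α β)) second)

-- Dimensions 0 and 1 are settled by direct trees, because the induction step needs dimension at
-- least 2 for powers of n to pay for anything.
sign-tree : ∀ n S .{{_ : ℕ.NonZero S}} (c : ℤ₂^ n → ℤ) h →
  Represents (+ S) (- + S) c h → SmallTree S h (norm c)
sign-tree zero            S c h rep = constant-tree h
sign-tree (suc zero)      S c h rep = one-variable-tree h
sign-tree (suc n@(suc _)) S c h rep = sign-node S (sign-tree n S) c h rep

-- Once the mean reaches 1 / 4 the recursion hands over to `sign-tree` for good; below it, the
-- restrictions are again indicators with the same S. Doubling the norm puts both cases on the scale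
-- B = 2A.
indicator-node : ∀ S .{{_ : ℕ.NonZero S}} .{{_ : ℕ.NonZero n}} →
  (∀ (d : ℤ₂^ n → ℤ) h → Represents 0ℤ (+ S) d h → SmallTree S h (2 ℕ.* norm d)) →
  ∀ (c : ℤ₂^ (suc n) → ℤ) h → Represents 0ℤ (+ S) c h → SmallTree S h (2 ℕ.* norm c)
indicator-node {n} S tree c h rep with ℤ.≤-total (+ S) (+ 4 * c 𝟎)
... | inj₁ large = convert (sign-tree (suc n) S flip h flip-represents)
  where
  open Indicator S {c = c} rep
  convert : SmallTree S h (norm flip) → SmallTree S h (2 ℕ.* norm c)
  convert (T , computes , small) = T , computes , small-mono (norm-flip large) small
... | inj₂ c𝟎-small with argmaxOff 𝟎 c
...   | inj₁ off                         = single-small-tree {c = c} {h} (0≢+S S) rep 𝟎 off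
...   | inj₂ (β , β≢𝟎 , cβ≢0 , max) = indicator-step S {c} {h} rep p
  (λ e → tree (restrict p e c) (λ x → h (insert p e x)) (represents-restrict p e {c} {h} rep)) cβ≢0 max c𝟎-small
  where
  p : Pivot β
  p = subst Pivot (⊕-identityˡ β) (pivot 𝟎 β (β≢𝟎 ∘ sym))

indicator-tree : ∀ n S .{{_ : ℕ.NonZero S}} (c : ℤ₂^ n → ℤ) h →
  Represents 0ℤ (+ S) c h → SmallTree S h (2 ℕ.* norm c)
indicator-tree zero            S c h rep = constant-tree h
indicator-tree (suc zero)      S c h rep = one-variable-tree h
indicator-tree (suc n@(suc _)) S c h rep = indicator-node S (indicator-tree n S) c h rep

-- Translation to the rational Fourier transform

toℚᵘ-/ : ∀ i d → toℚᵘ (i ℚ./ suc d) ≃ᵘ mkℚᵘ i d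
toℚᵘ-/ i d = ℚ.toℚᵘ-fromℚᵘ (mkℚᵘ i d)

ι : ℤ → ℚ
ι i = i ℚ./ 1

ι-+ : ∀ i j → ι (i + j) ≡ ι i ℚ.+ ι j
ι-+ i j = ℚ.toℚᵘ-injective (begin
  toℚᵘ (ι (i + j))              ≈⟨ toℚᵘ-/ (i + j) 0 ⟩
  mkℚᵘ (i + j) 0                ≈⟨ *≡* (cong (_* 1ℤ) (sym (cong₂ _+_ (ℤ.*-identityʳ i) (ℤ.*-identityʳ j)))) ⟩
  mkℚᵘ i 0 ℚᵘ.+ mkℚᵘ j 0        ≈⟨ ℚᵘ.+-cong (toℚᵘ-/ i 0) (toℚᵘ-/ j 0) ⟨
  toℚᵘ (ι i) ℚᵘ.+ toℚᵘ (ι j)    ≈⟨ ℚ.toℚᵘ-homo-+ (ι i) (ι j) ⟨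
  toℚᵘ (ι i ℚ.+ ι j)            ∎)
  where open import Relation.Binary.Reasoning.Setoid ℚᵘ.≃-setoid

/-*-ι : ∀ i d j → (i ℚ./ suc d) ℚ.* ι j ≡ (i * j) ℚ./ suc d
/-*-ι i d j = ℚ.toℚᵘ-injective (begin
  toℚᵘ ((i ℚ./ suc d) ℚ.* ι j)            ≈⟨ ℚ.toℚᵘ-homo-* (i ℚ./ suc d) (ι j) ⟩
  toℚᵘ (i ℚ./ suc d) ℚᵘ.* toℚᵘ (ι j)      ≈⟨ ℚᵘ.*-cong (toℚᵘ-/ i d) (toℚᵘ-/ j 0) ⟩
  mkℚᵘ i d ℚᵘ.* mkℚᵘ j 0
    ≈⟨ *≡* (cong (λ t → i * j * + t) (sym (ℕ.*-identityʳ (suc d)))) ⟩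
  mkℚᵘ (i * j) d                          ≈⟨ toℚᵘ-/ (i * j) d ⟨
  toℚᵘ ((i * j) ℚ./ suc d)                ∎)
  where open import Relation.Binary.Reasoning.Setoid ℚᵘ.≃-setoid

∣/∣ : ∀ i d → ℚ.∣ i ℚ./ suc d ∣ ≡ (+ ∣ i ∣) ℚ./ suc d
∣/∣ i d = ℚ.toℚᵘ-injective (begin
  toℚᵘ ℚ.∣ i ℚ./ suc d ∣        ≈⟨ ℚ.toℚᵘ-homo-∣-∣ (i ℚ./ suc d) ⟩
  ℚᵘ.∣ toℚᵘ (i ℚ./ suc d) ∣     ≈⟨ ℚᵘ.∣-∣-cong (toℚᵘ-/ i d) ⟩
  mkℚᵘ (+ ∣ i ∣) d              ≈⟨ toℚᵘ-/ (+ ∣ i ∣) d ⟨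
  toℚᵘ ((+ ∣ i ∣) ℚ./ suc d)    ∎)
  where open import Relation.Binary.Reasoning.Setoid ℚᵘ.≃-setoid

Σ-cong : {g h : ℤ₂^ n → ℚ} → (∀ x → g x ≡ h x) → Σ[ℤ₂^ n ] g ≡ Σ[ℤ₂^ n ] h
Σ-cong {zero}  e = e []
Σ-cong {suc n} e = cong₂ ℚ._+_ (Σ-cong (e ∘ (false ∷_))) (Σ-cong (e ∘ (true ∷_)))

Σ-* : ∀ k (g : ℤ₂^ n → ℚ) → Σ[ℤ₂^ n ] (λ x → k ℚ.* g x) ≡ k ℚ.* Σ[ℤ₂^ n ] g
Σ-* {zero}  k g = refl
Σ-* {suc n} k g = trans (cong₂ ℚ._+_ (Σ-* k (g ∘ (false ∷_))) (Σ-* k (g ∘ (true ∷_))))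
  (sym (ℚ.*-distribˡ-+ k (Σ[ℤ₂^ n ] (g ∘ (false ∷_))) (Σ[ℤ₂^ n ] (g ∘ (true ∷_)))))

Σ-ι : (c : ℤ₂^ n → ℤ) → Σ[ℤ₂^ n ] (λ x → ι (c x)) ≡ ι (∑ c)
Σ-ι {zero}  c = refl
Σ-ι {suc n} c = trans (cong₂ ℚ._+_ (Σ-ι (c ↾ false)) (Σ-ι (c ↾ true)))
                      (sym (ι-+ (∑ (c ↾ false)) (∑ (c ↾ true))))

indicator : (ℤ₂^ n → Bool) → ℤ₂^ n → ℤ
indicator f x = if f x then 1ℤ else 0ℤ

⟨,⟩-comm : (α x : ℤ₂^ n) → ⟨ α , x ⟩ ≡ ⟨ x , α ⟩
⟨,⟩-comm []      []      = refl
⟨,⟩-comm (a ∷ α) (b ∷ x) = cong₂ _xor_ (Bool.∧-comm a b) (⟨,⟩-comm α x)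

fourier≡ : ∀ (f : ℤ₂^ n → Bool) α →
  fourier f α ≡ (+ 1 ℚ./ (2 ℕ.^ n)) {{ℕ.m^n≢0 2 n}} ℚ.* ι (ev (indicator f) α)
fourier≡ {n} f α = cong ((+ 1 ℚ./ (2 ℕ.^ n)) {{ℕ.m^n≢0 2 n}} ℚ.*_)
  (trans (Σ-cong summand) (Σ-ι (λ x → indicator f x * sgn ⟨ x , α ⟩)))
  where
  summand : ∀ x → toℚ (f x) ℚ.* χ α x ≡ ι (indicator f x * sgn ⟨ x , α ⟩)
  summand x rewrite ⟨,⟩-comm α x with f x | ⟨ x , α ⟩
  ... | false | false = refl
  ... | false | true  = refl
  ... | true  | false = refl
  ... | true  | true  = refl

spectralNorm≡ : ∀ (f : ℤ₂^ n → Bool) →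
  spectralNorm f ≡ (+ norm (ev (indicator f)) ℚ./ (2 ℕ.^ n)) {{ℕ.m^n≢0 2 n}}
spectralNorm≡ {n} f = scaled (2 ℕ.^ n) {{ℕ.m^n≢0 2 n}} (fourier≡ f)
  where
  open ≡-Reasoning
  c = ev (indicator f)
  scaled : ∀ S .{{_ : ℕ.NonZero S}} → (∀ α → fourier f α ≡ (+ 1 ℚ./ S) ℚ.* ι (c α)) →
           spectralNorm f ≡ + norm c ℚ./ S
  scaled (suc d) eq = begin
    Σ[ℤ₂^ n ] (λ α → ℚ.∣ fourier f α ∣)
      ≡⟨ Σ-cong (λ α → trans (cong ℚ.∣_∣ (trans (eq α) (/-*-ι 1ℤ d (c α))))
           (trans (∣/∣ (1ℤ * c α) d) (cong (λ i → i ℚ./ suc d)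
             (trans (cong (λ i → + ∣ i ∣) (ℤ.*-identityˡ (c α))) (sym (ℤ.*-identityˡ (+ ∣ c α ∣))))))) ⟩
    Σ[ℤ₂^ n ] (λ α → (1ℤ * + ∣ c α ∣) ℚ./ suc d)
      ≡⟨ Σ-cong (λ α → /-*-ι 1ℤ d (+ ∣ c α ∣)) ⟨
    Σ[ℤ₂^ n ] (λ α → (1ℤ ℚ./ suc d) ℚ.* ι (+ ∣ c α ∣))
      ≡⟨ Σ-* (1ℤ ℚ./ suc d) (λ α → ι (+ ∣ c α ∣)) ⟩
    (1ℤ ℚ./ suc d) ℚ.* Σ[ℤ₂^ n ] (λ α → ι (+ ∣ c α ∣))
      ≡⟨ cong ((1ℤ ℚ./ suc d) ℚ.*_) (trans (Σ-ι (λ α → + ∣ c α ∣)) (cong ι (sym (norm≡∑ c)))) ⟩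
    (1ℤ ℚ./ suc d) ℚ.* ι (+ norm c)
      ≡⟨ /-*-ι 1ℤ d (+ norm c) ⟩
    (1ℤ * + norm c) ℚ./ suc d
      ≡⟨ cong (λ i → i ℚ./ suc d) (ℤ.*-identityˡ (+ norm c)) ⟩
    + norm c ℚ./ suc d ∎

cross-multiply : ∀ {x e d} → toℚᵘ x ≃ᵘ mkℚᵘ (+ e) d → ∣ ↥ x ∣ ℕ.* suc d ≡ e ℕ.* ↧ₙ x
cross-multiply {x@record{}} {e} {d} (*≡* eq) =
  trans (sym (ℤ.abs-* (↥ x) (+ suc d))) (trans (cong ∣_∣ eq) (ℤ.abs-* (+ e) (+ ↧ₙ x)))

-- The reduced fractions `a` and `b` are tied to J / S only by cross-multiplication, so both sides
-- are raised to a common power. With K = 2 J, dividing K² and 4 S K by 4 S² gives the exponents (J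
-- / S)² and 2 J / S.
clear-exponents : ∀ {s n S J} a b .{{_ : ℕ.NonZero S}} →
  ∣ ↥ a ∣ ℕ.* (S ℕ.* S) ≡ J ℕ.* J ℕ.* ↧ₙ a → ∣ ↥ b ∣ ℕ.* S ≡ 2 ℕ.* J ℕ.* ↧ₙ b →
  Bound S s n (2 ℕ.* J) → s ≤2^ a · n ^ b
clear-exponents {s} {n} {S} {J} a b p-eq r-eq (bounded bound) =
  ^-cancelˡ-≤ N {{ℕ.m*n≢0 4 (S ℕ.* S) {{_}} {{ℕ.m*n≢0 S S}}}} (begin
  (s ℕ.^ (q ℕ.* t)) ℕ.^ N           ≡⟨ ℕ.^-*-assoc s (q ℕ.* t) N ⟩
  s ℕ.^ (q ℕ.* t ℕ.* N)             ≡⟨ cong (s ℕ.^_) (ℕ.*-comm (q ℕ.* t) N) ⟩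
  s ℕ.^ (N ℕ.* (q ℕ.* t))           ≡⟨ ℕ.^-*-assoc s N (q ℕ.* t) ⟨
  (s ℕ.^ N) ℕ.^ (q ℕ.* t)           ≤⟨ ℕ.^-monoˡ-≤ (q ℕ.* t) bound ⟩
  (2 ℕ.^ E ℕ.* n ℕ.^ M) ℕ.^ (q ℕ.* t)
    ≡⟨ ^-distrib-* (2 ℕ.^ E) (n ℕ.^ M) (q ℕ.* t) ⟩
  (2 ℕ.^ E) ℕ.^ (q ℕ.* t) ℕ.* (n ℕ.^ M) ℕ.^ (q ℕ.* t)
    ≡⟨ cong₂ ℕ._*_ (ℕ.^-*-assoc 2 E (q ℕ.* t)) (ℕ.^-*-assoc n M (q ℕ.* t)) ⟩
  2 ℕ.^ (E ℕ.* (q ℕ.* t)) ℕ.* n ℕ.^ (M ℕ.* (q ℕ.* t))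
    ≡⟨ cong₂ (λ i j → 2 ℕ.^ i ℕ.* n ℕ.^ j) E-eq M-eq ⟩
  2 ℕ.^ (p ℕ.* t ℕ.* N) ℕ.* n ℕ.^ (r ℕ.* q ℕ.* N)
    ≡⟨ cong₂ ℕ._*_ (ℕ.^-*-assoc 2 (p ℕ.* t) N) (ℕ.^-*-assoc n (r ℕ.* q) N) ⟨
  (2 ℕ.^ (p ℕ.* t)) ℕ.^ N ℕ.* (n ℕ.^ (r ℕ.* q)) ℕ.^ N
    ≡⟨ ^-distrib-* (2 ℕ.^ (p ℕ.* t)) (n ℕ.^ (r ℕ.* q)) N ⟨
  (2 ℕ.^ (p ℕ.* t) ℕ.* n ℕ.^ (r ℕ.* q)) ℕ.^ N ∎)
  where
  open ℕ.≤-Reasoning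
  p = ∣ ↥ a ∣
  q = ↧ₙ a
  r = ∣ ↥ b ∣
  t = ↧ₙ b
  N = 4 ℕ.* (S ℕ.* S)
  E = 2 ℕ.* J ℕ.* (2 ℕ.* J)
  M = 4 ℕ.* (S ℕ.* (2 ℕ.* J))
  lemma₁ : ∀ J q t → 2 ℕ.* J ℕ.* (2 ℕ.* J) ℕ.* (q ℕ.* t) ≡ J ℕ.* J ℕ.* q ℕ.* (4 ℕ.* t)
  lemma₁ = ℕ-Ring.solve-∀
  lemma₂ : ∀ p S t → p ℕ.* (S ℕ.* S) ℕ.* (4 ℕ.* t) ≡ p ℕ.* t ℕ.* (4 ℕ.* (S ℕ.* S))
  lemma₂ = ℕ-Ring.solve-∀
  lemma₃ : ∀ S J q t → 4 ℕ.* (S ℕ.* (2 ℕ.* J)) ℕ.* (q ℕ.* t) ≡ 2 ℕ.* J ℕ.* t ℕ.* (4 ℕ.* S ℕ.* q)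
  lemma₃ = ℕ-Ring.solve-∀
  lemma₄ : ∀ r S q → r ℕ.* S ℕ.* (4 ℕ.* S ℕ.* q) ≡ r ℕ.* q ℕ.* (4 ℕ.* (S ℕ.* S))
  lemma₄ = ℕ-Ring.solve-∀
  E-eq : E ℕ.* (q ℕ.* t) ≡ p ℕ.* t ℕ.* N
  E-eq = trans (lemma₁ J q t) (trans (cong (ℕ._* (4 ℕ.* t)) (sym p-eq)) (lemma₂ p S t))
  M-eq : M ℕ.* (q ℕ.* t) ≡ r ℕ.* q ℕ.* N
  M-eq = trans (lemma₃ S J q t) (trans (cong (ℕ._* (4 ℕ.* S ℕ.* q)) (sym r-eq)) (lemma₄ r S q))

bound⇒≤2^ : ∀ {s n} J S .{{_ : ℕ.NonZero S}} {A} → A ≡ + J ℚ./ S → Bound S s n (2 ℕ.* J) →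
  s ≤2^ (A ℚ.* A) · n ^ ((+ 2 ℚ./ 1) ℚ.* A)
bound⇒≤2^ {s} {n} J (suc d) {A} refl bound = clear-exponents {J = J} (A ℚ.* A) ((+ 2 ℚ./ 1) ℚ.* A)
  (cross-multiply {A ℚ.* A} (begin
    toℚᵘ (A ℚ.* A)                      ≈⟨ ℚ.toℚᵘ-homo-* A A ⟩
    toℚᵘ A ℚᵘ.* toℚᵘ A                  ≈⟨ ℚᵘ.*-cong (toℚᵘ-/ (+ J) d) (toℚᵘ-/ (+ J) d) ⟩
    mkℚᵘ (+ J) d ℚᵘ.* mkℚᵘ (+ J) d      ≡⟨ cong (λ i → mkℚᵘ i (d ℕ.+ d ℕ.* suc d)) (ℤ.pos-* J J) ⟨
    mkℚᵘ (+ (J ℕ.* J)) (d ℕ.+ d ℕ.* suc d) ∎))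
  (cross-multiply {(+ 2 ℚ./ 1) ℚ.* A} (begin
    toℚᵘ ((+ 2 ℚ./ 1) ℚ.* A)            ≈⟨ ℚ.toℚᵘ-homo-* (+ 2 ℚ./ 1) A ⟩
    toℚᵘ (+ 2 ℚ./ 1) ℚᵘ.* toℚᵘ A        ≈⟨ ℚᵘ.*-cong (toℚᵘ-/ (+ 2) 0) (toℚᵘ-/ (+ J) d) ⟩
    mkℚᵘ (+ 2) 0 ℚᵘ.* mkℚᵘ (+ J) d      ≡⟨ cong₂ mkℚᵘ (sym (ℤ.pos-* 2 J)) (ℕ.+-identityʳ d) ⟩
    mkℚᵘ (+ (2 ℕ.* J)) d                ∎))
  bound
  where open import Relation.Binary.Reasoning.Setoid ℚᵘ.≃-setoid

-- One transform of `f` gives its Fourier coefficients times 2^n, and a second one returns 2^n · f.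
-- This fixes S = 2^n.
indicator-represents : ∀ (f : ℤ₂^ n → Bool) → Represents 0ℤ (+ (2 ℕ.^ n)) (ev (indicator f)) f
indicator-represents {n} f x with f x | ev-involutive (indicator f) x
... | false | eq = trans eq (ℤ.*-zeroʳ (+ (2 ℕ.^ n)))
... | true  | eq = trans eq (ℤ.*-identityʳ (+ (2 ℕ.^ n)))

-- Removes the alternative of a small tree. A nonzero indicator has A ≥ 1, hence B = 2A ≥ 2 and size
-- 2 fits; the zero function has B = 0 and needs a single leaf.
bounded-tree : ∀ n .{{_ : ℕ.NonZero n}} S .{{_ : ℕ.NonZero S}} (c : ℤ₂^ n → ℤ) h →
  Represents 0ℤ (+ S) c h → ∃[ T ] (T Computes h × Bound S (size T) n (2 ℕ.* norm c))
bounded-tree n S c h rep = root (argmax c)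
  where
  open Indicator S {c = c} rep
  shrink : ∀ {α} → c α ≢ 0ℤ → SmallTree S h (2 ℕ.* norm c) →
           ∃[ T ] (T Computes h × Bound S (size T) n (2 ℕ.* norm c))
  shrink cα≢0 (T , computes , small) =
    T , computes , small⇒bound small (ℕ.*-monoʳ-≤ 2 (S≤norm cα≢0)) ℕ.≤-refl
  zero-value : (∀ γ → c γ ≡ 0ℤ) → ∀ x → 0ℤ ≡ (if h x then + S else 0ℤ)
  zero-value c≡0 x = trans (sym (trans (ev-cong c≡0 x) (∑-zero {n}))) (rep x)
  zero-tree : (∀ γ → c γ ≡ 0ℤ) → ∃[ T ] (T Computes h × Bound S (size T) n (2 ℕ.* norm c))
  zero-tree c≡0 = leaf false ,
    (λ x → trans (sym (dec-false (0ℤ ℤ.≟ + S) (0≢+S S)))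
                 (label-correct (h x) (0≢+S S) (zero-value c≡0 x))) ,
    bounded (ℕ.≤-trans (ℕ.≤-reflexive (ℕ.^-zeroˡ (4 ℕ.* (S ℕ.* S))))
      (ℕ.*-mono-≤ (ℕ.m^n>0 2 (2 ℕ.* norm c ℕ.* (2 ℕ.* norm c)))
                  (ℕ.m^n>0 n (4 ℕ.* (S ℕ.* (2 ℕ.* norm c))))))
  root : ∃[ α ] (∀ γ → ∣ c γ ∣ ℕ.≤ ∣ c α ∣) → ∃[ T ] (T Computes h × Bound S (size T) n (2 ℕ.* norm c))
  root (α , max) with c α ℤ.≟ 0ℤ
  ... | no  cα≢0 = shrink cα≢0 (indicator-tree n S c h rep)
  ... | yes cα≡0 = zero-tree λ γ →
    ℤ.∣i∣≡0⇒i≡0 (ℕ.n≤0⇒n≡0 (subst (λ i → ∣ c γ ∣ ℕ.≤ ∣ i ∣) cα≡0 (max γ)))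

theorem1p2 : ∀ (n : ℕ) → 1 ℕ.≤ n → (f : ℤ₂^ n → Bool) (A : ℚ) → spectralNorm f ≡ A →
    ∃[ T ] (T Computes f × size T ≤2^ (A ℚ.* A) · n ^ ((+ 2 ℚ./ 1) ℚ.* A))
theorem1p2 n 1≤n f A norm≡A
  with bounded-tree n {{ℕ.>-nonZero 1≤n}} (2 ℕ.^ n) {{ℕ.m^n≢0 2 n}} (ev (indicator f)) f (indicator-represents f)
... | T , computes , bound = T , computes ,
  bound⇒≤2^ (norm (ev (indicator f))) (2 ℕ.^ n) {{ℕ.m^n≢0 2 n}} (trans (sym norm≡A) (spectralNorm≡ f)) bound
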